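{- Let $n,m,\delta$ be integers with $\delta \geq n$ and $\delta \geq \frac{m+5}{3}$. If $\mathcal{H}$ is a 2-connected hypergraph with $n$ vertices, $m$ edges and minimum degree at least $\delta$, then $\mathcal{H}$ has a hamiltonian Berge cycle.
   Context: A hypergraph $\mathcal{H}$ consists of a vertex set $V(\mathcal{H})$ and an edge set $E(\mathcal{H})$ whose elements are subsets of $V(\mathcal{H})$ (of arbitrary sizes). The degree of a vertex is the number of edges containing it. A Berge cycle of length $\ell$ consists of $\ell$ distinct vertices $v_1,\dots,v_\ell$ and $\ell$ distinct edges $e_1,\dots,e_\ell$ with $v_i, v_{i+1} \in e_i$ for all $i$ (indices mod $\ell$); $v_1,\dots,v_\ell$ are its base vertices. A hamiltonian Berge cycle is a Berge cycle whose set of base vertices is $V(\mathcal{H})$. The incidence graph $I(\mathcal{H})$ is the bipartite graph with parts $X = V(\mathcal{H})$ and $Y = E(\mathcal{H})$, where $v \in X$ is adjacent to $e \in Y$ iff $v \in e$. $\mathcal{H}$ is 2-connected if $I(\mathcal{H})$ is 2-connected. -}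

module Defs where

open import Level using (0ℓ)
open import Data.Empty using (⊥)
open import Data.Fin using (Fin; toℕ)
open import Data.Fin.Properties using (nonZeroIndex)
open import Data.Fin.Subset using (Subset; _∈_)
open import Data.Fin.Subset.Properties using (_∈?_)
open import Data.List using (length; filter; allFin)
open import Data.Nat using (ℕ; suc; _≤_)
open import Data.Nat.DivMod using (_mod_)
open import Data.Product using (Σ-syntax; ∃-syntax; _×_)
open import Data.Sum using (_⊎_; inj₁; inj₂)
open import Function.Bundles using (_↣_)
open import Function.Definitions using (Injective)
open import Relation.Binary.Core using (Rel)
open import Relation.Binary.Definitions using (Symmetric; Irreflexive)
open import Relation.Binary.Construct.Closure.ReflexiveTransitive using (Star)
open import Relation.Binary.PropositionalEquality using (_≡_; _≢_)

record Graph : Set₁ where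
  field
    Vertex : Set
    Adj    : Rel Vertex 0ℓ
    sym    : Symmetric Adj
    irrefl : Irreflexive _≡_ Adj

  Connected : Set
  Connected = ∀ u v → Star Adj u v

  -- Adjacency in the graph with the vertex w deleted.
  Adj∖ : Vertex → Rel Vertex 0ℓ
  Adj∖ w u v = u ≢ w × v ≢ w × Adj u v

  ConnectedWithout : Vertex → Set
  ConnectedWithout w = ∀ u v → u ≢ w → v ≢ w → Star (Adj∖ w) u v

  record TwoConnected : Set where
    field
      threeVertices : Fin 3 ↣ Vertex
      connected     : Connected
      noCutVertex   : ∀ w → ConnectedWithout w

-- Vertex set Fin n; the edge set is a set of exactly m subsets of Fin n,
-- enumerated without repetition. Edges of any size, including ∅, are allowed.
record Hypergraph (n m : ℕ) : Set where
  field
    edge           : Fin m → Subset n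
    edge-injective : Injective _≡_ _≡_ edge

  degree : Fin n → ℕ
  degree v = length (filter (λ e → v ∈? edge e) (allFin m))

  Incident : Rel (Fin n ⊎ Fin m) 0ℓ
  Incident (inj₁ v) (inj₂ e) = v ∈ edge e
  Incident (inj₂ e) (inj₁ v) = v ∈ edge e
  Incident (inj₁ _) (inj₁ _) = ⊥
  Incident (inj₂ _) (inj₂ _) = ⊥

  private
    incident-sym : Symmetric Incident
    incident-sym {inj₁ _} {inj₂ _} p = p
    incident-sym {inj₂ _} {inj₁ _} p = p

    incident-irrefl : Irreflexive _≡_ Incident
    incident-irrefl {inj₁ _} _≡_.refl ()
    incident-irrefl {inj₂ _} _≡_.refl ()

  incidenceGraph : Graph
  incidenceGraph = record
    { Vertex = Fin n ⊎ Fin m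
    ; Adj    = Incident
    ; sym    = λ {x} {y} → incident-sym {x} {y}
    ; irrefl = incident-irrefl
    }

  MinDegree≥ : ℕ → Set
  MinDegree≥ δ = ∀ v → δ ≤ degree v

  TwoConnected : Set
  TwoConnected = Graph.TwoConnected incidenceGraph

-- i ↦ i + 1 modulo ℓ
next : ∀ {ℓ} → Fin ℓ → Fin ℓ
next {ℓ} i = _mod_ (suc (toℕ i)) ℓ {{nonZeroIndex i}}

module _ {n m : ℕ} (H : Hypergraph n m) where
  open Hypergraph H

  record BergeCycle (ℓ : ℕ) : Set where
    field
      base            : Fin ℓ → Fin n
      base-injective  : Injective _≡_ _≡_ base
      label           : Fin ℓ → Fin m
      label-injective : Injective _≡_ _≡_ label
      base∈           : ∀ i → base i ∈ edge (label i)
      next∈           : ∀ i → base (next i) ∈ edge (label i)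

  IsHamiltonian : ∀ {ℓ} → BergeCycle ℓ → Set
  IsHamiltonian C = ∀ v → ∃[ i ] BergeCycle.base C i ≡ v

  HasHamiltonianBergeCycle : Set
  HasHamiltonianBergeCycle = ∃[ ℓ ] Σ[ C ∈ BergeCycle ℓ ] IsHamiltonian C

{-# OPTIONS --safe #-}

-- Work in the incidence graph, with parts X (vertices) and Y (edges), and suppose that a
-- longest cycle C, with c vertices of X, misses a vertex of X.
--
-- Counting. Let P be a path with ends s, s′ in X and more than c vertices of X. Vertices
-- linked by paths on the vertex set of P have no common neighbour off P, so m ≤ 3δ − 5
-- bounds from below the total degree into P of three or more pairwise linked vertices.
-- A vertex z inside P is a crossing if its two neighbours w, w′ on P satisfy s ~ w′ and
-- s′ ~ w. Then the rest of P closes up to a cycle, and s, s′ and all crossings have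
-- pairwise no common neighbour off P, while the number of crossings is at least the
-- degree of s plus that of s′ into P, minus the number of X-vertices of P.
--
-- No x off C has two neighbours on C. Otherwise x and the predecessors on C of its
-- neighbours are pairwise linked, and each such pair bounds a path with many crossings.
-- By 2-connectivity every crossing misses at least two Y-vertices of C, which forces
-- every vertex left out by such a cycle to have degree at most 3 into it; then there is
-- at most one crossing, against the degree count for the predecessors.
--
-- Ears. 2-connectivity gives a path off C, with an X-vertex, joining two distinct vertices
-- of C. Going around C along a shortest such ear yields a path without crossings whose
-- ends, together with the first X-vertex x₁ of the ear, share no neighbours off the path;
-- as x₁ has degree at most 3 into it, this contradicts the count.

module Submission where

open import Data.Empty using (⊥; ⊥-elim)
open import Data.Fin using (Fin; zero; suc; inject₁; fromℕ)
import Data.Fin.Properties as Fin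
open import Data.Fin.Relation.Unary.Top using (view; ‵fromℕ; ‵inject₁)
open import Data.Fin.Subset using () renaming (_∈_ to _∈ₛ_)
open import Data.Fin.Subset.Properties using () renaming (_∈?_ to _∈ₛ?_)
open import Data.List using (List; []; _∷_; _++_; length; filter; allFin; map; concat)
open import Data.List.Membership.Propositional using (_∈_; _∉_)
open import Data.List.Membership.Propositional.Properties
  using (∈-++⁺ʳ; ∈-++⁺ˡ; ∈-++⁻; ∈-∃++; ∈-length; ∈-filter⁺; ∈-filter⁻; ∈-allFin; ∈-map⁺; ∈-map⁻)
open import Data.List.Properties using (++-assoc; length-++; filter-++; length-tabulate; length-map)
open import Data.List.Relation.Binary.Permutation.Propositional
  using (_↭_; ↭-refl; ↭-sym; ↭-trans; ↭-prep; prep; swap; ↭-reflexive)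
open import Data.List.Relation.Binary.Permutation.Propositional.Properties
  using (++-comm; ++⁺; ++⁺ˡ; ↭-length; filter-↭; ++-commutativeMonoid; ∈-resp-↭; All-resp-↭; shift)
open import Data.List.Relation.Unary.All using (All; []; _∷_)
import Data.List.Relation.Unary.All as All
import Data.List.Relation.Unary.All.Properties as All
open import Data.List.Relation.Unary.AllPairs using (AllPairs; []; _∷_)
import Data.List.Relation.Unary.AllPairs as AllPairs
import Data.List.Relation.Unary.AllPairs.Properties as AllPairs
open import Data.List.Relation.Unary.Any using (here; there)
open import Data.List.Relation.Unary.Unique.Propositional using (Unique)
open import Data.List.Relation.Unary.Unique.Propositional.Properties as Uniqueₚ using (allFin⁺)
open import Data.Nat using (ℕ; zero; suc; _+_; _*_; _∸_; _≤_; _<_; _≥_; z≤n; s≤s)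
open import Data.Nat.DivMod using (_%_; m<n⇒m%n≡m; n%n≡0)
open import Data.Nat.ListAction using (sum)
open import Data.Nat.Properties
open import Algebra.Properties.CommutativeSemigroup +-commutativeSemigroup using (interchange)
import Data.Nat.Tactic.RingSolver as ℕ-Solver
open import Data.Product using (∃-syntax; ∃₂; _×_; _,_; proj₁; proj₂)
open import Data.Sum using (_⊎_; inj₁; inj₂)
import Data.Sum.Properties as Sum
open import Data.Vec using (Vec; []; _∷_; lookup)
open import Function using (_∘_; _∋_)
open import Relation.Binary.Construct.Closure.ReflexiveTransitive using (Star; ε; _◅_)
open import Relation.Binary.Definitions using (Symmetric; DecidableEquality)
open import Relation.Binary.PropositionalEquality
open import Relation.Nullary using (¬_; Dec; yes; no)
open import Relation.Nullary.Decidable using (_×-dec_; _→-dec_; ¬?; map′; decidable-stable)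
open import Relation.Unary using (Decidable)
open import Defs

-- Counting and distinctness of list entries up to reordering.

module _ {A : Set} {P : A → Set} (P? : Decidable P) where

  count : List A → ℕ
  count L = length (filter P? L)

  count-++ : ∀ L M → count (L ++ M) ≡ count L + count M
  count-++ L M = trans (cong length (filter-++ P? L M)) (length-++ (filter P? L))

  count-↭ : ∀ {L M} → L ↭ M → count L ≡ count M
  count-↭ σ = ↭-length (filter-↭ P? σ)

module _ {A : Set} where

  AllPairs-resp-↭ : {R : A → A → Set} → Symmetric R →
    ∀ {L M : List A} → L ↭ M → AllPairs R L → AllPairs R M
  AllPairs-resp-↭ s _↭_.refl rs = rs
  AllPairs-resp-↭ s (prep x σ) (r ∷ rs) = All-resp-↭ σ r ∷ AllPairs-resp-↭ s σ rs
  AllPairs-resp-↭ s (swap x y σ) ((r ∷ r₁) ∷ r₂ ∷ rs) =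
    (s r ∷ All-resp-↭ σ r₂) ∷ All-resp-↭ σ r₁ ∷ AllPairs-resp-↭ s σ rs
  AllPairs-resp-↭ s (_↭_.trans σ τ) rs = AllPairs-resp-↭ s τ (AllPairs-resp-↭ s σ rs)

  Unique-resp-↭ : {L M : List A} → L ↭ M → Unique L → Unique M
  Unique-resp-↭ = AllPairs-resp-↭ ≢-sym

  Unique-++⁻ˡ : (L : List A) {M : List A} → Unique (L ++ M) → Unique L
  Unique-++⁻ˡ [] u = []
  Unique-++⁻ˡ (x ∷ L) (p ∷ u) = All.++⁻ˡ L p ∷ Unique-++⁻ˡ L u

  Unique-++⁻ʳ : (L : List A) {M : List A} → Unique (L ++ M) → Unique M
  Unique-++⁻ʳ [] u = u
  Unique-++⁻ʳ (x ∷ L) (p ∷ u) = Unique-++⁻ʳ L u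

  ∉⇒All≢ : {x : A} {L : List A} → x ∉ L → All (x ≢_) L
  ∉⇒All≢ {L = []} _ = []
  ∉⇒All≢ {L = y ∷ L} x∉ = (λ e → x∉ (here e)) ∷ ∉⇒All≢ (x∉ ∘ there)

  All≢⇒∉ : {x : A} {L : List A} → All (x ≢_) L → x ∉ L
  All≢⇒∉ a x∈ = All.lookup a x∈ refl

-- Paths and cycles of a symmetric relation.

module Paths {V : Set} (_~_ : V → V → Set) (~-sym : Symmetric _~_) where

  infixr 5 _∷_

  data Path : V → V → List V → Set where
    [_] : ∀ a → Path a a (a ∷ [])
    _∷_ : ∀ {a b c L} → a ~ b → Path b c L → Path a c (a ∷ L)

  -- The vertex list of an actual path matters only up to order.
  record Pth (a b : V) (L : List V) : Set where
    constructor pth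
    field
      {verts} : List V
      path    : Path a b verts
      verts↭  : verts ↭ L

  fromPath : ∀ {a b L} → Path a b L → Pth a b L
  fromPath p = pth p ↭-refl

  reorder : ∀ {a b L M} → L ↭ M → Pth a b L → Pth a b M
  reorder σ (pth p τ) = pth p (↭-trans τ σ)

  _⟨_⟩ₚ_ : ∀ {a b c d L M} → Path a b L → b ~ c → Path c d M → Path a d (L ++ M)
  [ a ] ⟨ e ⟩ₚ q = e ∷ q
  (d ∷ p) ⟨ e ⟩ₚ q = d ∷ (p ⟨ e ⟩ₚ q)

  infixr 4 _⟨_⟩_
  _⟨_⟩_ : ∀ {a b c d L M} → Pth a b L → b ~ c → Pth c d M → Pth a d (L ++ M)
  pth p σ ⟨ e ⟩ pth q τ = pth (p ⟨ e ⟩ₚ q) (++⁺ σ τ)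

  pt : ∀ a → Pth a a (a ∷ [])
  pt a = fromPath [ a ]

  rev : ∀ {a b L} → Pth a b L → Pth b a L
  rev (pth p σ) = reorder σ (go p)
    where
    go : ∀ {a b L} → Path a b L → Pth b a L
    go [ a ] = pt a
    go {a} {L = .a ∷ L} (e ∷ p) = reorder (++-comm L (a ∷ [])) (go p ⟨ ~-sym e ⟩ pt a)

  startsWith : ∀ {a b L} → Path a b L → ∃[ M ] (L ≡ a ∷ M)
  startsWith [ a ] = [] , refl
  startsWith (e ∷ p) = _ , refl

  end∈ : ∀ {a b L} → Path a b L → b ∈ L
  end∈ [ a ] = here refl
  end∈ (e ∷ p) = there (end∈ p)

  first∈ : ∀ {a b L} → Pth a b L → a ∈ L
  first∈ (pth p σ) with startsWith p
  ... | _ , refl = ∈-resp-↭ σ (here refl)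

  last∈ : ∀ {a b L} → Pth a b L → b ∈ L
  last∈ (pth p σ) = ∈-resp-↭ σ (end∈ p)

  data SplitAfter (a b v : V) : List V → Set where
    whole : ∀ {L} → v ≡ b → SplitAfter a b v L
    parts : ∀ {r M N} → Path a v M → v ~ r → Path r b N → SplitAfter a b v (M ++ N)

  splitAfter : ∀ {a b v L} → Path a b L → v ∈ L → SplitAfter a b v L
  splitAfter [ a ] (here refl) = whole refl
  splitAfter (e ∷ p) (here refl) = parts [ _ ] e p
  splitAfter (e ∷ p) (there v∈) with splitAfter p v∈
  ... | whole eq = whole eq
  ... | parts q d r = parts (e ∷ q) d r

  data SplitAround (a b v : V) : List V → Set where
    around : ∀ {p r M N} → Path a p M → p ~ v → v ~ r → Path r b N →
             SplitAround a b v (M ++ v ∷ N)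

  splitAround : ∀ {a b c v L} → a ~ b → Path b c L → v ∈ L → v ≢ c →
                SplitAround a c v (a ∷ L)
  splitAround e [ b ] (here v≡b) v≢b = ⊥-elim (v≢b v≡b)
  splitAround e (d ∷ p) (here refl) v≢c = around [ _ ] e d p
  splitAround e (d ∷ p) (there v∈) v≢c = extend e (splitAround d p v∈ v≢c)
    where
    extend : ∀ {a b c v L} → a ~ b → SplitAround b c v L → SplitAround a c v (a ∷ L)
    extend e (around q x y r) = around (e ∷ q) x y r

  record Unsnoc (a b : V) (L : List V) : Set where
    constructor unsnoc
    field
      {butLast} : V
      {rest}    : List V
      initial   : Pth a butLast rest
      lastEdge  : butLast ~ b
      rest↭     : b ∷ rest ↭ L

  mkUnsnoc : ∀ {a b L} → a ≢ b → Pth a b L → Unsnoc a b L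
  mkUnsnoc a≢b p with rev p
  ... | pth [ _ ] σ = ⊥-elim (a≢b refl)
  ... | pth (e ∷ q) σ = unsnoc (rev (fromPath q)) (~-sym e) σ

  -- A single edge traversed in both directions also qualifies. It provides a first cycle with one
  -- vertex of X, and corresponds to a Berge cycle of length one.
  record Cycle (L : List V) : Set where
    constructor cyc
    field
      {from to} : V
      path      : Pth from to L
      closing   : to ~ from

  rotate : ∀ {L q} → Cycle L → q ∈ L → ∃[ r ] (Pth r q L × q ~ r)
  rotate (cyc (pth p σ) c) q∈ with splitAfter p (∈-resp-↭ (↭-sym σ) q∈)
  ... | whole refl = _ , pth p σ , c
  ... | parts {r} {M} {N} s e t =
        r , reorder (↭-trans (++-comm N M) σ) (fromPath t ⟨ c ⟩ fromPath s) , e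

  -- Paths into a vertex set that avoid a deleted vertex.

  module Search (_≟_ : DecidableEquality V) where

    open import Data.List.Membership.DecPropositional _≟_ using (_∈?_)

    suffixFrom : ∀ {a b v L} → Path a b L → v ∈ L → ∃₂ λ N M → Path v b M × L ≡ N ++ M
    suffixFrom [ a ] (here refl) = [] , _ , [ a ] , refl
    suffixFrom (e ∷ p) (here refl) = [] , _ , e ∷ p , refl
    suffixFrom {L = a ∷ _} (e ∷ p) (there v∈) with suffixFrom p v∈
    ... | N , M , q , eq = a ∷ N , M , q , cong (a ∷_) eq

    record Hit (S : List V) (w s : V) : Set where
      constructor hit
      field
        {last hitPoint} : V
        {inner}         : List V
        path            : Path s last inner
        unique          : Unique inner
        outside         : All (_∉ S) inner
        avoids          : w ∉ inner
        reach           : last ~ hitPoint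
        hit∈            : hitPoint ∈ S
        hit≢            : hitPoint ≢ w

    -- The walk is stopped when it first enters `S`. Loops are erased from the back: if the start
    -- recurs on the path found so far, `suffixFrom` keeps only what follows the recurrence.
    firstHit : ∀ {S w s t} → Star (λ u v → u ≢ w × v ≢ w × u ~ v) s t → s ∉ S → t ∈ S → Hit S w s
    firstHit ε s∉ t∈ = ⊥-elim (s∉ t∈)
    firstHit {S} {w} {s} (_◅_ {j = r} (s≢w , r≢w , s~r) rest) s∉ t∈ with r ∈? S
    ... | yes r∈ = hit [ s ] ([] ∷ []) (s∉ ∷ []) (λ { (here w≡s) → s≢w (sym w≡s) }) s~r r∈ r≢w
    ... | no r∉ with firstHit rest r∉ t∈
    ... | hit {inner = L} p u o a c h∈ h≢ with s ∈? L
    ... | no s∉L = hit (s~r ∷ p) (∉⇒All≢ s∉L ∷ u) (s∉ ∷ o)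
                     (λ { (here w≡s) → s≢w (sym w≡s) ; (there w∈) → a w∈ }) c h∈ h≢
    ... | yes s∈L with suffixFrom p s∈L
    ... | N , M , q , refl =
          hit q (Unique-++⁻ʳ N u) (All.++⁻ʳ N o) (λ w∈ → a (∈-++⁺ʳ N w∈)) c h∈ h≢

Unique-⊆⇒length≤ : {A : Set} {L M : List A} → Unique L → (∀ {x} → x ∈ L → x ∈ M) →
                   length L ≤ length M
Unique-⊆⇒length≤ [] sub = z≤n
Unique-⊆⇒length≤ {L = x ∷ L} {M} (x∉ ∷ u) sub with ∈-∃++ (sub (here refl))
... | M₁ , M₂ , refl = begin
    suc (length L)              ≤⟨ s≤s (Unique-⊆⇒length≤ u sub′) ⟩
    length (x ∷ M₁ ++ M₂)       ≡⟨ ↭-length (shift x M₁ M₂) ⟨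
    length (M₁ ++ x ∷ M₂)       ∎
  where
  open ≤-Reasoning
  sub′ : ∀ {z} → z ∈ L → z ∈ M₁ ++ M₂
  sub′ z∈ with ∈-resp-↭ (shift x M₁ M₂) (sub (there z∈))
  ... | here refl = ⊥-elim (All≢⇒∉ x∉ z∈)
  ... | there z∈′ = z∈′

-- The incidence graph and degrees into vertex lists.

module Bipartite {n m : ℕ} (H : Hypergraph n m) where
  open Hypergraph H

  V : Set
  V = Fin n ⊎ Fin m

  infix 4 _~_
  _~_ : V → V → Set
  _~_ = Incident

  ~-sym : Symmetric _~_
  ~-sym {inj₁ _} {inj₂ _} p = p
  ~-sym {inj₂ _} {inj₁ _} p = p

  _~?_ : ∀ u v → Dec (u ~ v)
  inj₁ _ ~? inj₁ _ = no λ ()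
  inj₁ x ~? inj₂ y = x ∈ₛ? edge y
  inj₂ y ~? inj₁ x = x ∈ₛ? edge y
  inj₂ _ ~? inj₂ _ = no λ ()

  _≟V_ : DecidableEquality V
  _≟V_ = Sum.≡-dec Fin._≟_ Fin._≟_

  open import Data.List.Membership.DecPropositional _≟V_ public using (_∈?_)
  open Paths _~_ (λ {u} {v} → ~-sym {u} {v}) public
  open Search _≟V_ public

  data IsX : V → Set where
    isX : ∀ {x} → IsX (inj₁ x)

  data IsY : V → Set where
    isY : ∀ {y} → IsY (inj₂ y)

  isX? : Decidable IsX
  isX? (inj₁ _) = yes isX
  isX? (inj₂ _) = no λ ()

  isY? : Decidable IsY
  isY? (inj₁ _) = no λ ()
  isY? (inj₂ _) = yes isY

  #X #Y : List V → ℕ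
  #X = count isX?
  #Y = count isY?

  #X-∈ : ∀ {x L} → inj₁ x ∈ L → 1 ≤ #X L
  #X-∈ x∈ = ∈-length (∈-filter⁺ isX? x∈ isX)

  deg : Fin n → List V → ℕ
  deg x = count (inj₁ x ~?_)

  deg≤#Y : ∀ x L → deg x L ≤ #Y L
  deg≤#Y x [] = z≤n
  deg≤#Y x (inj₁ _ ∷ L) = deg≤#Y x L
  deg≤#Y x (inj₂ y ∷ L) with x ∈ₛ? edge y
  ... | yes _ = s≤s (deg≤#Y x L)
  ... | no _ = m≤n⇒m≤1+n (deg≤#Y x L)

  deg-adj : ∀ {x y} L → x ∈ₛ edge y → deg x (inj₂ y ∷ L) ≡ suc (deg x L)
  deg-adj {x} {y} L x∈ with x ∈ₛ? edge y
  ... | yes _ = refl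
  ... | no x∉ = ⊥-elim (x∉ x∈)

  deg-nonadj : ∀ {x y} L → ¬ x ∈ₛ edge y → deg x (inj₂ y ∷ L) ≡ deg x L
  deg-nonadj {x} {y} L x∉ with x ∈ₛ? edge y
  ... | yes x∈ = ⊥-elim (x∉ x∈)
  ... | no _ = refl

  deg-∈ : ∀ {x y L} → inj₂ y ∈ L → x ∈ₛ edge y → 1 ≤ deg x L
  deg-∈ {x} y∈ x∈ = ∈-length (∈-filter⁺ (inj₁ x ~?_) y∈ x∈)

  neighbour∈ : ∀ {x} L → 1 ≤ deg x L → ∃[ y ] (inj₂ y ∈ L × x ∈ₛ edge y)
  neighbour∈ (inj₁ _ ∷ L) 1≤ with neighbour∈ L 1≤
  ... | y , y∈ , x∈ = y , there y∈ , x∈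
  neighbour∈ {x} (inj₂ y ∷ L) 1≤ with x ∈ₛ? edge y
  ... | yes x∈ = y , here refl , x∈
  ... | no _ with neighbour∈ L 1≤
  ...   | y′ , y∈ , x∈ = y′ , there y∈ , x∈

  deg-missing : ∀ {z b} M → inj₂ b ∈ M → ¬ z ∈ₛ edge b → deg z M < #Y M
  deg-missing (inj₁ _ ∷ M) (there b∈) z∉ = deg-missing M b∈ z∉
  deg-missing {z} (inj₂ b ∷ M) (here refl) z∉ with z ∈ₛ? edge b
  ... | yes z∈ = ⊥-elim (z∉ z∈)
  ... | no _ = s≤s (deg≤#Y z M)
  deg-missing {z} (inj₂ y ∷ M) (there b∈) z∉ with z ∈ₛ? edge y
  ... | yes _ = s≤s (deg-missing M b∈ z∉)
  ... | no _ = m≤n⇒m≤1+n (deg-missing M b∈ z∉)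

  deg-missing₂ : ∀ {z a b K M} → inj₂ a ∷ M ↭ K → inj₂ b ∈ M →
                 ¬ z ∈ₛ edge a → ¬ z ∈ₛ edge b → 2 + deg z K ≤ #Y K
  deg-missing₂ {z} {a} {b} {K} {M} σ b∈ z∉a z∉b = begin
    2 + deg z K              ≡⟨ cong (2 +_) (count-↭ (inj₁ z ~?_) σ) ⟨
    2 + deg z (inj₂ a ∷ M)   ≡⟨ cong (2 +_) (deg-nonadj M z∉a) ⟩
    2 + deg z M              ≤⟨ s≤s (deg-missing M b∈ z∉b) ⟩
    suc (#Y M)               ≡⟨ count-↭ isY? σ ⟩
    #Y K                     ∎
    where open ≤-Reasoning

  mutual
    #X-pathXX : ∀ {a b L} → Path (inj₁ a) (inj₁ b) L → #X L ≡ suc (#Y L)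
    #X-pathXX [ _ ] = refl
    #X-pathXX (_∷_ {b = inj₂ _} e p) = cong suc (#X-pathYX p)

    #X-pathYX : ∀ {a b L} → Path (inj₂ a) (inj₁ b) L → #X L ≡ #Y L
    #X-pathYX (_∷_ {b = inj₁ _} e p) = #X-pathXX p

  #X≡#Y-cycle : ∀ {L} → Cycle L → #X L ≡ #Y L
  #X≡#Y-cycle (cyc {inj₁ _} {inj₂ _} p c) with rev p
  ... | pth q σ = trans (sym (count-↭ isX? σ)) (trans (#X-pathYX q) (count-↭ isY? σ))
  #X≡#Y-cycle (cyc {inj₂ _} {inj₁ _} (pth q σ) c) =
    trans (sym (count-↭ isX? σ)) (trans (#X-pathYX q) (count-↭ isY? σ))

  Disj : List V → Fin n → Fin n → Set
  Disj L x x′ = ∀ y → inj₂ y ∉ L → x ∈ₛ edge y → x′ ∈ₛ edge y → ⊥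

  Σdeg : List V → List (Fin n) → ℕ
  Σdeg L Q = sum (map (λ q → deg q L) Q)

  -- Counting edges by disjoint neighbourhoods.

  module Family {δ : ℕ} (minDegree : MinDegree≥ δ) where

    ysOf : List V → List (Fin m)
    ysOf [] = []
    ysOf (inj₁ _ ∷ L) = ysOf L
    ysOf (inj₂ y ∷ L) = y ∷ ysOf L

    length-ysOf : ∀ L → length (ysOf L) ≡ #Y L
    length-ysOf [] = refl
    length-ysOf (inj₁ _ ∷ L) = length-ysOf L
    length-ysOf (inj₂ _ ∷ L) = cong suc (length-ysOf L)

    ∈-ysOf⁺ : ∀ {y L} → inj₂ y ∈ L → y ∈ ysOf L
    ∈-ysOf⁺ (here refl) = here refl
    ∈-ysOf⁺ {L = inj₁ _ ∷ L} (there y∈) = ∈-ysOf⁺ y∈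
    ∈-ysOf⁺ {L = inj₂ _ ∷ L} (there y∈) = there (∈-ysOf⁺ y∈)

    ∈-ysOf⁻ : ∀ {y} L → y ∈ ysOf L → inj₂ y ∈ L
    ∈-ysOf⁻ (inj₁ _ ∷ L) y∈ = there (∈-ysOf⁻ L y∈)
    ∈-ysOf⁻ (inj₂ _ ∷ L) (here refl) = here refl
    ∈-ysOf⁻ (inj₂ _ ∷ L) (there y∈) = there (∈-ysOf⁻ L y∈)

    Unique-ysOf : ∀ {L} → Unique L → Unique (ysOf L)
    Unique-ysOf [] = []
    Unique-ysOf {inj₁ _ ∷ L} (p ∷ u) = Unique-ysOf u
    Unique-ysOf {inj₂ _ ∷ L} (p ∷ u) = ∉⇒All≢ (All≢⇒∉ p ∘ ∈-ysOf⁻ L) ∷ Unique-ysOf u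

    private
      fresh? : ∀ L q → Decidable (λ y → q ∈ₛ edge y × inj₂ y ∉ L)
      fresh? L q y = (q ∈ₛ? edge y) ×-dec ¬? (inj₂ y ∈? L)

      fresh : List V → Fin n → List (Fin m)
      fresh L q = filter (fresh? L q) (allFin m)

      used : Fin n → List V → List (Fin m)
      used q L = filter (λ y → q ∈ₛ? edge y) (ysOf L)

      length-used : ∀ q L → length (used q L) ≡ deg q L
      length-used q [] = refl
      length-used q (inj₁ _ ∷ L) = length-used q L
      length-used q (inj₂ y ∷ L) with q ∈ₛ? edge y
      ... | yes _ = cong suc (length-used q L)
      ... | no _ = length-used q L

    degree≤ : ∀ L q → degree q ≤ length (fresh L q) + deg q L
    degree≤ L q = begin
        degree q                                  ≤⟨ Unique-⊆⇒length≤ (Uniqueₚ.filter⁺ _ (allFin⁺ m)) sub ⟩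
        length (fresh L q ++ used q L)            ≡⟨ length-++ (fresh L q) ⟩
        length (fresh L q) + length (used q L)    ≡⟨ cong (length (fresh L q) +_) (length-used q L) ⟩
        length (fresh L q) + deg q L              ∎
      where
      open ≤-Reasoning
      sub : ∀ {y} → y ∈ filter (λ y → q ∈ₛ? edge y) (allFin m) → y ∈ fresh L q ++ used q L
      sub {y} y∈ with ∈-filter⁻ (λ y → q ∈ₛ? edge y) {xs = allFin m} y∈ | inj₂ y ∈? L
      ... | _ , q∈ | yes y∈L = ∈-++⁺ʳ (fresh L q) (∈-filter⁺ (λ y → q ∈ₛ? edge y) (∈-ysOf⁺ y∈L) q∈)
      ... | _ , q∈ | no y∉L = ∈-++⁺ˡ (∈-filter⁺ (fresh? L q) (∈-allFin y) (q∈ , y∉L))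

    freshNeighbour : ∀ L q → deg q L < δ → ∃[ y ] (inj₂ y ∉ L × q ∈ₛ edge y)
    freshNeighbour L q d<δ with fresh L q in eq | degree≤ L q
    ... | [] | le = ⊥-elim (<⇒≱ d<δ (≤-trans (minDegree q) le))
    ... | y ∷ _ | _ with ∈-filter⁻ (fresh? L q) {xs = allFin m} (subst (y ∈_) (sym eq) (here refl))
    ...   | _ , q∈ , y∉ = y , y∉ , q∈

    private
      freshAll : List V → List (Fin n) → List (Fin m)
      freshAll L Q = concat (map (fresh L) Q)

      length-freshAll : ∀ L Q → length Q * δ ≤ length (freshAll L Q) + Σdeg L Q
      length-freshAll L [] = z≤n
      length-freshAll L (q ∷ Q) = begin
          δ + length Q * δ
            ≤⟨ +-mono-≤ (≤-trans (minDegree q) (degree≤ L q)) (length-freshAll L Q) ⟩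
          (a + b) + (c + d)
            ≡⟨ interchange a b c d ⟩
          (a + c) + (b + d)
            ≡⟨ cong (_+ (b + d)) (length-++ (fresh L q)) ⟨
          length (fresh L q ++ freshAll L Q) + (b + d) ∎
        where
        open ≤-Reasoning
        a = length (fresh L q)
        b = deg q L
        c = length (freshAll L Q)
        d = Σdeg L Q

    -- The Y-vertices of `L` and the sets of neighbours off `L`, one set for each member of `Q`, are
    -- pairwise disjoint among the `m` edges. The set of `q` has at least `δ` minus `deg q L`
    -- elements.
    family : ∀ {L Q} → Unique L → AllPairs (Disj L) Q → #Y L + length Q * δ ≤ m + Σdeg L Q
    family {L} {Q} u ds = begin
        #Y L + length Q * δ
          ≤⟨ +-monoʳ-≤ (#Y L) (length-freshAll L Q) ⟩
        #Y L + (length (freshAll L Q) + Σdeg L Q)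
          ≡⟨ +-assoc (#Y L) _ _ ⟨
        #Y L + length (freshAll L Q) + Σdeg L Q
          ≡⟨ cong (λ k → k + length (freshAll L Q) + Σdeg L Q) (length-ysOf L) ⟨
        length (ysOf L) + length (freshAll L Q) + Σdeg L Q
          ≡⟨ cong (_+ Σdeg L Q) (length-++ (ysOf L)) ⟨
        length (concat (ysOf L ∷ map (fresh L) Q)) + Σdeg L Q
          ≤⟨ +-monoˡ-≤ (Σdeg L Q) (Unique-⊆⇒length≤ {M = allFin m} unique (λ {x} _ → ∈-allFin x)) ⟩
        length (allFin m) + Σdeg L Q
          ≡⟨ cong (_+ Σdeg L Q) (length-tabulate {n = m} (λ i → i)) ⟩
        m + Σdeg L Q ∎
      where
      open ≤-Reasoning
      fresh⁻ : ∀ q {y} → y ∈ fresh L q → q ∈ₛ edge y × inj₂ y ∉ L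
      fresh⁻ q y∈ = proj₂ (∈-filter⁻ (fresh? L q) {xs = allFin m} y∈)
      unique : Unique (concat (ysOf L ∷ map (fresh L) Q))
      unique = Uniqueₚ.concat⁺
        (Unique-ysOf u ∷ All.map⁺ (All.universal (λ q → Uniqueₚ.filter⁺ (fresh? L q) (allFin⁺ m)) Q))
        (All.map⁺ (All.universal (λ q {_} (y∈ , y∈′) → proj₂ (fresh⁻ q y∈′) (∈-ysOf⁻ L y∈)) Q)
         ∷ AllPairs.map⁺ (AllPairs.map (λ {q} {q′} d {_} (y∈ , y∈′) →
             d _ (proj₂ (fresh⁻ q y∈)) (proj₁ (fresh⁻ q y∈)) (proj₁ (fresh⁻ q′ y∈′))) ds))

  open import Algebra.Solver.CommutativeMonoid (++-commutativeMonoid {A = V})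
    using (solve; _⊕_; _⊜_) public

  -- Two neighbours on the cycle supply two predecessors. With `z` these are three linked vertices,
  -- the least number on which `m + 5 ≤ 3δ` bears.
  Omits : List V → Fin n → Set
  Omits L z = ∃[ K ] (Cycle K × inj₁ z ∷ K ↭ L × 2 ≤ deg z K)

  -- Crossings of a path with more than `c` vertices of X.

  module Longest {c : ℕ} (longest : ∀ {L} → Cycle L → Unique L → #X L ≤ c) where

    tooLong : ∀ {M} → Unique M → c < #X M → ¬ Cycle M
    tooLong u c< C = <⇒≱ c< (longest C u)

    Disj-from-cycle : ∀ {L x x′} → Unique L → c < #X L →
                      (∀ {y} → x ∈ₛ edge y → x′ ∈ₛ edge y → Cycle (inj₂ y ∷ L)) → Disj L x x′
    Disj-from-cycle u c< f _ y∉ x∈ x′∈ =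
      tooLong (∉⇒All≢ y∉ ∷ u) c< (f x∈ x′∈)

    -- A common neighbour off the path would close it to a cycle with more than `c` vertices of X.
    Disj-ends : ∀ {L x x′} → Unique L → c < #X L → Pth (inj₁ x) (inj₁ x′) L → Disj L x x′
    Disj-ends u c< p = Disj-from-cycle u c< (λ x∈ x′∈ → cyc (pt (inj₂ _) ⟨ x∈ ⟩ p) x′∈)

    -- A crossing at z of a path from s to s′: the neighbours w₁, w₂ of z on the path
    -- satisfy s ~ w₂ and s′ ~ w₁, so that the rest of the path closes up to a cycle.
    record Mid (s s′ : Fin n) (w : Fin m) (M : List V) (z : Fin n) : Set where
      constructor mid
      field
        {q}      : V
        {w₁ w₂}  : Fin m
        {M₁ M₂}  : List V
        front    : Path (inj₂ w) (inj₂ w₁) M₁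
        z∈w₁     : z ∈ₛ edge w₁
        z∈w₂     : z ∈ₛ edge w₂
        w₂~q     : inj₂ w₂ ~ q
        back     : Path q (inj₁ s′) M₂
        s∈w₂     : s ∈ₛ edge w₂
        s′∈w₁    : s′ ∈ₛ edge w₁
        M≡       : M ≡ M₁ ++ inj₁ z ∷ inj₂ w₂ ∷ M₂

    extend : ∀ {s s′ w z w′ M x} → inj₂ w ~ inj₁ z → inj₁ z ~ inj₂ w′ → Mid s s′ w′ M x →
             Mid s s′ w (inj₂ w ∷ inj₁ z ∷ M) x
    extend e d (mid f a b g k h i refl) = mid (e ∷ d ∷ f) a b g k h i refl

    module _ {L : List V} (unique : Unique L) (c< : c < #X L) (s s′ : Fin n) where

      record CrossingsFrom (w : Fin m) (M : List V) : Set where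
        constructor crossingsFrom
        field
          zs       : List (Fin n)
          mids     : All (Mid s s′ w (inj₂ w ∷ M)) zs
          disjoint : AllPairs (Disj L) zs
          bound    : deg s M + deg s′ (inj₂ w ∷ M) ≤ #Y (inj₂ w ∷ M) + length zs

      -- Let `z` come before `z′`. With a common neighbour `y`, the cycle s ... w z y z′ w₂ ... s′
      -- w₁ ... w′ s covers `L` and `y`. It uses `s ~ w′` from the crossing at `z` and `s′ ~ w₁`
      -- from the one at `z′`.
      Disj-crossings : ∀ {p w z w′ z′ A M} →
        Pth (inj₁ s) p A → p ~ inj₂ w → z ∈ₛ edge w → s ∈ₛ edge w′ →
        Mid s s′ w′ M z′ → A ++ inj₂ w ∷ inj₁ z ∷ M ↭ L → Disj L z z′
      Disj-crossings {w = w} {z} {A = A} pre p~w z∈w s∈w′ (mid {w₂ = w₂} {M₁} {M₂} f a b g k h i refl) σ =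
        Disj-from-cycle unique c< λ {y} z∈ z′∈ → record
          { path = reorder (↭-trans (solve 8 (λ A w z y x v B M → (A ⊕ w ⊕ z ⊕ y ⊕ x ⊕ v ⊕ B ⊕ M)
                                           ⊜ (y ⊕ A ⊕ w ⊕ z ⊕ M ⊕ x ⊕ v ⊕ B)) ↭-refl
                     A (inj₂ w ∷ []) (inj₁ z ∷ []) (inj₂ y ∷ []) (inj₁ _ ∷ []) (inj₂ w₂ ∷ []) M₂ M₁)
                     (↭-prep _ σ))
              (pre ⟨ p~w ⟩ pt (inj₂ w) ⟨ z∈w ⟩ pt (inj₁ z) ⟨ z∈ ⟩ pt (inj₂ y) ⟨ z′∈ ⟩ pt (inj₁ _)
                 ⟨ b ⟩ pt (inj₂ w₂) ⟨ g ⟩ fromPath k ⟨ i ⟩ rev (fromPath f))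
          ; closing = s∈w′ }

      -- A neighbour of `s` is charged to the X-vertex before it, a neighbour of `s′` to the
      -- X-vertex after it. An inner vertex charged twice is a crossing. If `s` is adjacent to `w`,
      -- the charge falls before this part of the path, whence `deg s M` without `w` in the bound.
      crossings : ∀ {p w A M} → Pth (inj₁ s) p A → p ~ inj₂ w →
        Path (inj₂ w) (inj₁ s′) (inj₂ w ∷ M) → A ++ inj₂ w ∷ M ↭ L → CrossingsFrom w M
      crossings {w = w} pre p~w (_ ∷ [ inj₁ z ]) σ = crossingsFrom [] [] [] le
        where
        le : deg s′ (inj₂ w ∷ inj₁ z ∷ []) ≤ 1
        le with s′ ∈ₛ? edge w
        ... | yes _ = s≤s z≤n
        ... | no _ = z≤n
      crossings {w = w} {A = A} pre p~w (_∷_ {b = inj₁ z} e (_∷_ {b = inj₂ w′} {L = .(inj₂ w′) ∷ M} d p@(_∷_ {b = q} f r))) σ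
        with s′ ∈ₛ? edge w | s ∈ₛ? edge w′
           | crossings (pre ⟨ p~w ⟩ pt (inj₂ w) ⟨ e ⟩ pt (inj₁ z)) d p
               (↭-trans (↭-reflexive (++-assoc A _ _)) σ)
      ... | yes s′∈ | yes s∈ | crossingsFrom zs ms ds le =
              crossingsFrom (z ∷ zs)
                (mid [ _ ] e d f r s∈ s′∈ refl ∷ All.map (extend e d) ms)
                (All.map (λ md → Disj-crossings pre p~w e s∈ md σ) ms ∷ ds)
                (begin
                  deg s (inj₂ w′ ∷ M) + deg s′ (inj₂ w ∷ inj₁ z ∷ inj₂ w′ ∷ M)
                    ≡⟨ cong₂ _+_ (deg-adj M s∈) (deg-adj (inj₁ z ∷ inj₂ w′ ∷ M) s′∈) ⟩
                  suc (deg s M) + suc (deg s′ (inj₂ w′ ∷ M))  ≡⟨ cong suc (+-suc (deg s M) _) ⟩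
                  2 + (deg s M + deg s′ (inj₂ w′ ∷ M))        ≤⟨ s≤s (s≤s le) ⟩
                  2 + (#Y (inj₂ w′ ∷ M) + length zs)          ≡⟨ cong suc (+-suc (#Y (inj₂ w′ ∷ M)) _) ⟨
                  suc (#Y (inj₂ w′ ∷ M) + suc (length zs))    ∎)
        where open ≤-Reasoning
      ... | yes s′∈ | no s∉ | crossingsFrom zs ms ds le =
              crossingsFrom zs (All.map (extend e d) ms) ds
                (subst₂ (λ a b → a + b ≤ suc (#Y (inj₂ w′ ∷ M) + length zs))
                  (sym (deg-nonadj M s∉)) (sym (deg-adj (inj₁ z ∷ inj₂ w′ ∷ M) s′∈))
                  (subst (_≤ suc (#Y (inj₂ w′ ∷ M) + length zs)) (sym (+-suc (deg s M) _)) (s≤s le)))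
      ... | no s′∉ | s∈? | crossingsFrom zs ms ds le =
              crossingsFrom zs (All.map (extend e d) ms) ds
                (subst (λ b → deg s (inj₂ w′ ∷ M) + b ≤ suc (#Y (inj₂ w′ ∷ M) + length zs))
                  (sym (deg-nonadj (inj₁ z ∷ inj₂ w′ ∷ M) s′∉))
                  (≤-trans (+-monoˡ-≤ _ (deg-∷≤ (inj₂ w′) M)) (s≤s le)))
        where
        deg-∷≤ : ∀ v M → deg s (v ∷ M) ≤ suc (deg s M)
        deg-∷≤ v M with inj₁ s ~? v
        ... | yes _ = ≤-refl
        ... | no _ = n≤1+n _

    record PathCrossings (L : List V) (s s′ : Fin n) : Set where
      constructor pathCrossings
      field
        zs       : List (Fin n)
        omits    : All (Omits L) zs
        disjoint : AllPairs (Disj L) (s ∷ s′ ∷ zs)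
        bound    : deg s L + deg s′ L ≤ suc (#Y L) + length zs

    -- Here `suc (#Y L)` is the number of X-vertices of the path; the extra one beyond `crossings`
    -- pays for the first step from `s`. A crossing `z` leaves the cycle s ... w₁ s′ ... w₂ s.
    -- Opened before `s` or before `s′` and prolonged by `z`, it links `z` to either end.
    path-crossings : ∀ {L s s′} → Unique L → c < #X L → 1 ≤ c → Pth (inj₁ s) (inj₁ s′) L →
                     PathCrossings L s s′
    path-crossings u c< 1≤c (pth [ _ ] σ) =
      ⊥-elim (<⇒≱ (≤-<-trans 1≤c c<) (≤-reflexive (sym (count-↭ isX? σ))))
    path-crossings {L} {s} {s′} u c< 1≤c (pth (_∷_ {b = inj₂ w} {L = .(inj₂ w) ∷ M} e p@(_ ∷ _)) σ) =
      pathCrossings zs (All.map omit mids)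
        ((Disj-ends u c< (pth (e ∷ p) σ) ∷ All.map near mids) ∷ All.map far mids ∷ disjoint)
        (begin
          deg s L + deg s′ L
            ≡⟨ cong₂ _+_ (count-↭ (inj₁ s ~?_) σ) (count-↭ (inj₁ s′ ~?_) σ) ⟨
          deg s (inj₂ w ∷ M) + deg s′ (inj₂ w ∷ M)
            ≡⟨ cong (_+ deg s′ (inj₂ w ∷ M)) (deg-adj M e) ⟩
          suc (deg s M + deg s′ (inj₂ w ∷ M))
            ≤⟨ s≤s bound ⟩
          suc (#Y (inj₂ w ∷ M)) + length zs
            ≡⟨ cong (λ k → suc k + length zs) (count-↭ isY? σ) ⟩
          suc (#Y L) + length zs ∎)
      where
      open ≤-Reasoning
      open CrossingsFrom (crossings u c< s s′ (pt (inj₁ s)) e p σ)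
      omit : ∀ {z} → Mid s s′ w (inj₂ w ∷ M) z → Omits L z
      omit {z} (mid {w₂ = w₂} {M₁} {M₂} f a b g k h i eq) =
        _ , cyc (pt (inj₁ s) ⟨ e ⟩ fromPath f ⟨ i ⟩ rev (fromPath k) ⟨ ~-sym {inj₂ w₂} g ⟩ pt (inj₂ w₂)) h
          , ↭-trans (solve 5 (λ z s w A B → (z ⊕ s ⊕ A ⊕ B ⊕ w) ⊜ (s ⊕ A ⊕ z ⊕ w ⊕ B)) ↭-refl
              (inj₁ z ∷ []) (inj₁ s ∷ []) (inj₂ w₂ ∷ []) M₁ M₂) σ′
          , subst (2 ≤_) (count-↭ (inj₁ z ~?_) (solve 4 (λ s w A B → (w ⊕ s ⊕ A ⊕ B) ⊜ (s ⊕ A ⊕ B ⊕ w)) ↭-refl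
              (inj₁ s ∷ []) (inj₂ w₂ ∷ []) M₁ M₂))
              (subst (2 ≤_) (sym (deg-adj _ b)) (s≤s (deg-∈ {L = inj₁ s ∷ M₁ ++ M₂} (there (∈-++⁺ˡ (end∈ f))) a)))
        where
        σ′ : inj₁ s ∷ M₁ ++ inj₁ z ∷ inj₂ w₂ ∷ M₂ ↭ L
        σ′ = subst (λ M → inj₁ s ∷ M ↭ L) eq σ
      near : ∀ {z} → Mid s s′ w (inj₂ w ∷ M) z → Disj L s z
      near {z} (mid {w₂ = w₂} {M₁} {M₂} f a b g k h i eq) = Disj-ends u c< (reorder
        (↭-trans (solve 5 (λ z s w A B → (s ⊕ A ⊕ B ⊕ w ⊕ z) ⊜ (s ⊕ A ⊕ z ⊕ w ⊕ B)) ↭-refl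
              (inj₁ z ∷ []) (inj₁ s ∷ []) (inj₂ w₂ ∷ []) M₁ M₂)
          (subst (λ M → inj₁ s ∷ M ↭ L) eq σ))
        (pt (inj₁ s) ⟨ e ⟩ fromPath f ⟨ i ⟩ rev (fromPath k) ⟨ ~-sym {inj₂ w₂} g ⟩ pt (inj₂ w₂) ⟨ b ⟩ pt (inj₁ z)))
      far : ∀ {z} → Mid s s′ w (inj₂ w ∷ M) z → Disj L s′ z
      far {z} (mid {w₂ = w₂} {M₁} {M₂} f a b g k h i eq) = Disj-ends u c< (rev (reorder
        (↭-trans (solve 5 (λ z s w A B → (z ⊕ A ⊕ s ⊕ w ⊕ B) ⊜ (s ⊕ A ⊕ z ⊕ w ⊕ B)) ↭-refl
              (inj₁ z ∷ []) (inj₁ s ∷ []) (inj₂ w₂ ∷ []) M₁ M₂)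
          (subst (λ M → inj₁ s ∷ M ↭ L) eq σ))
        (pt (inj₁ z) ⟨ a ⟩ rev (fromPath f) ⟨ e ⟩ pt (inj₁ s) ⟨ h ⟩ pt (inj₂ w₂) ⟨ g ⟩ fromPath k)))

    -- Predecessors of the neighbours of a missed vertex.

    record Tail (x : Fin n) (e a : V) (M : List V) (s : Fin n) : Set where
      constructor tail
      field
        {y}    : Fin m
        {r}    : V
        {A B}  : List V
        front  : Path a (inj₁ s) A
        s∈y    : s ∈ₛ edge y
        x∈y    : x ∈ₛ edge y
        y~r    : inj₂ y ~ r
        back   : Path r e B
        M≡     : M ≡ A ++ inj₂ y ∷ B

    -- The closed path u … e y₀, with x adjacent to y₀, misses x only.
    module Predecessors {L K : List V} {x u e : Fin n} {y₀ : Fin m}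
      (u~y₀ : u ∈ₛ edge y₀) (e~y₀ : e ∈ₛ edge y₀) (x~y₀ : x ∈ₛ edge y₀)
      (L↭ : inj₁ x ∷ inj₂ y₀ ∷ K ↭ L) where

      Linked : Fin n → Fin n → Set
      Linked s s′ = Pth (inj₁ s) (inj₁ s′) L

      record Preds (a : Fin n) (M : List V) : Set where
        constructor preds
        field
          ts     : List (Fin n)
          tails  : All (Tail x (inj₁ e) (inj₁ a) (inj₁ a ∷ M)) ts
          linked : AllPairs Linked ts
          toEnd  : All (λ s → Linked s e) ts
          size   : length ts ≡ deg x M

      -- The path is a ... u y₀ e ... yₗ x y a′ ... s: backwards from `a` around to the later
      -- neighbour `yₗ` of `x`, then through `x` to the stretch between the two predecessors.
      linkTail : ∀ {a y a′ M s A} → Pth (inj₁ u) (inj₁ a) A → a ∈ₛ edge y → x ∈ₛ edge y →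
        a′ ∈ₛ edge y → Tail x (inj₁ e) (inj₁ a′) M s → A ++ inj₂ y ∷ M ↭ K → Linked a s
      linkTail {y = y} {A = A} pre a∈ x∈ a′∈ (tail {y = yₗ} {A = M₁} {M₂} f s∈ x∈ₗ g k refl) σ = reorder
        (↭-trans (solve 7 (λ A y₀ B v x y M → (A ⊕ y₀ ⊕ B ⊕ v ⊕ x ⊕ y ⊕ M) ⊜ (x ⊕ y₀ ⊕ A ⊕ y ⊕ M ⊕ v ⊕ B)) ↭-refl
           A (inj₂ y₀ ∷ []) M₂ (inj₂ yₗ ∷ []) (inj₁ x ∷ []) (inj₂ y ∷ []) M₁)
           (↭-trans (↭-prep _ (↭-prep _ σ)) L↭))
        (rev pre ⟨ u~y₀ ⟩ pt (inj₂ y₀) ⟨ e~y₀ ⟩ rev (fromPath k) ⟨ ~-sym {inj₂ yₗ} g ⟩ pt (inj₂ yₗ)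
          ⟨ x∈ₗ ⟩ pt (inj₁ x) ⟨ x∈ ⟩ pt (inj₂ y) ⟨ a′∈ ⟩ fromPath f)

      -- For the predecessor `e` of `y₀` the later neighbour is `y₀` itself: a ... u y₀ x y a′ ...
      -- e.
      linkEnd : ∀ {a y a′ A M} → Pth (inj₁ u) (inj₁ a) A → a ∈ₛ edge y → x ∈ₛ edge y →
        a′ ∈ₛ edge y → Path (inj₁ a′) (inj₁ e) M → A ++ inj₂ y ∷ M ↭ K → Linked a e
      linkEnd {y = y} {A = A} {M} pre a∈ x∈ a′∈ p σ = reorder
        (↭-trans (solve 5 (λ A y₀ x y M → (A ⊕ y₀ ⊕ x ⊕ y ⊕ M) ⊜ (x ⊕ y₀ ⊕ A ⊕ y ⊕ M)) ↭-refl
           A (inj₂ y₀ ∷ []) (inj₁ x ∷ []) (inj₂ y ∷ []) M)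
           (↭-trans (↭-prep _ (↭-prep _ σ)) L↭))
        (rev pre ⟨ u~y₀ ⟩ pt (inj₂ y₀) ⟨ x~y₀ ⟩ pt (inj₁ x) ⟨ x∈ ⟩ pt (inj₂ y) ⟨ a′∈ ⟩ fromPath p)

      extendTail : ∀ {a y a′ s M} → a ∈ₛ edge y → a′ ∈ₛ edge y →
        Tail x (inj₁ e) (inj₁ a′) M s → Tail x (inj₁ e) (inj₁ a) (inj₁ a ∷ inj₂ y ∷ M) s
      extendTail {y = y} p q (tail f b c g k refl) = tail (_∷_ {b = inj₂ y} p (q ∷ f)) b c g k refl

      predecessors : ∀ {a A M} → Pth (inj₁ u) (inj₁ a) A → Path (inj₁ a) (inj₁ e) (inj₁ a ∷ M) →
                     A ++ M ↭ K → Preds a M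
      predecessors pre [ _ ] σ = preds [] [] [] [] refl
      predecessors {a} {A} pre (_∷_ {b = inj₂ y} a∈ (_∷_ {b = inj₁ a′} a′∈ p)) σ
        with startsWith p
      ... | M , refl
        with x ∈ₛ? edge y
           | predecessors (pre ⟨ a∈ ⟩ pt (inj₂ y) ⟨ a′∈ ⟩ pt (inj₁ a′)) p
               (↭-trans (↭-reflexive (++-assoc A _ _)) σ)
      ... | no x∉ | preds ts tl lk te sz = preds ts (All.map (extendTail a∈ a′∈) tl) lk te
              (trans sz (sym (deg-nonadj (inj₁ a′ ∷ M) x∉)))
      ... | yes x∈ | preds ts tl lk te sz = preds (a ∷ ts)
              (tail [ _ ] a∈ x∈ a′∈ p refl ∷ All.map (extendTail a∈ a′∈) tl)
              (All.map (λ t → linkTail pre a∈ x∈ a′∈ t σ) tl ∷ lk)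
              (linkEnd pre a∈ x∈ a′∈ p σ ∷ te)
              (trans (cong suc sz) (sym (deg-adj (inj₁ a′ ∷ M) x∈)))

    Linked : List V → Fin n → Fin n → Set
    Linked L s s′ = Pth (inj₁ s) (inj₁ s′) L

    -- `T` collects the predecessors on the cycle of all neighbours of `x`, with `e` the one of
    -- `y₀`. Cutting the cycle right after a predecessor leaves a path that starts at a neighbour of
    -- `x`, which links `x` to that predecessor.
    linkedFamily : ∀ {L x} → Omits L x →
                   ∃[ T ] (AllPairs (Linked L) (x ∷ T) × length T ≡ deg x L)
    linkedFamily {L} {x} (K , C , σ , 2≤) with neighbour∈ K (≤-trans (s≤s z≤n) 2≤)
    ... | y₀ , y₀∈ , x~y₀ with rotate C y₀∈
    ... | inj₁ u , P , y₀~u with mkUnsnoc (λ ()) P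
    ... | unsnoc {inj₁ e} (pth p τ) e~y₀ ρ with startsWith p
    ... | M , refl = e ∷ ts , (linked₀ All.∷ All.map linked₁ tails) AllPairs.∷ (All.map rev toEnd AllPairs.∷ linked)
                   , trans (cong suc size) (trans (sym (deg-adj (inj₁ u ∷ M) x~y₀)) (count-↭ (inj₁ x ~?_) L↭))
      where
      L↭ : inj₁ x ∷ inj₂ y₀ ∷ inj₁ u ∷ M ↭ L
      L↭ = ↭-trans (↭-prep _ (↭-trans (↭-prep _ τ) ρ)) σ
      open Predecessors {u = u} {e = e} y₀~u e~y₀ x~y₀ L↭ hiding (Linked)
      open Preds (predecessors (pt (inj₁ u)) p ↭-refl)
      linked₀ : Linked L x e
      linked₀ = reorder L↭ (pt (inj₁ x) ⟨ x~y₀ ⟩ pt (inj₂ y₀) ⟨ y₀~u ⟩ fromPath p)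
      linked₁ : ∀ {s} → Tail x (inj₁ e) (inj₁ u) (inj₁ u ∷ M) s → Linked L x s
      linked₁ (tail {y = y} {A = A} {B} f s∈ x∈ g k eq) = reorder
        (↭-trans (solve 5 (λ x y B y₀ A → (x ⊕ y ⊕ B ⊕ y₀ ⊕ A) ⊜ (x ⊕ y₀ ⊕ A ⊕ y ⊕ B)) ↭-refl
          (inj₁ x ∷ []) (inj₂ y ∷ []) B (inj₂ y₀ ∷ []) A)
          (subst (λ M → inj₁ x ∷ inj₂ y₀ ∷ M ↭ L) eq L↭))
        (pt (inj₁ x) ⟨ x∈ ⟩ pt (inj₂ y) ⟨ g ⟩ fromPath k ⟨ e~y₀ ⟩ pt (inj₂ y₀) ⟨ y₀~u ⟩ fromPath f)

    -- Degree sums of linked families.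

    module Counting {δ : ℕ} (minDegree : MinDegree≥ δ) (m+5≤3δ : m + 5 ≤ 3 * δ) (c<δ : c < δ) where
      open Family minDegree

      -- In `family`, three members of `Q` use up `m + 5 ≤ 3δ`; each of the other `r` contributes
      -- `δ`, which exceeds `c`.
      family₃ : ∀ {L Q} r → Unique L → AllPairs (Disj L) Q → length Q ≡ 3 + r →
                #Y L + 5 + r * suc c ≤ Σdeg L Q
      family₃ {L} {Q} r u ds eq = ≤-trans (+-monoʳ-≤ (#Y L + 5) (*-monoʳ-≤ r c<δ))
        (+-cancelˡ-≤ (m + 3 * δ) _ _ (begin
          m + 3 * δ + (#Y L + 5 + r * δ)
            ≡⟨ solve-eq₁ m (3 * δ) (#Y L) (r * δ) ⟩
          (m + 5) + (#Y L + (3 * δ + r * δ))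
            ≡⟨ cong (λ k → m + 5 + (#Y L + k)) (*-distribʳ-+ δ 3 r) ⟨
          (m + 5) + (#Y L + (3 + r) * δ)
            ≡⟨ cong (λ k → m + 5 + (#Y L + k * δ)) eq ⟨
          (m + 5) + (#Y L + length Q * δ)
            ≤⟨ +-mono-≤ m+5≤3δ (family u ds) ⟩
          3 * δ + (m + Σdeg L Q)
            ≡⟨ solve-eq₂ (3 * δ) m (Σdeg L Q) ⟩
          m + 3 * δ + Σdeg L Q ∎))
        where
        open ≤-Reasoning
        solve-eq₁ : ∀ m d y r → m + d + (y + 5 + r) ≡ (m + 5) + (y + (d + r))
        solve-eq₁ = ℕ-Solver.solve-∀
        solve-eq₂ : ∀ d m s → d + (m + s) ≡ m + d + s
        solve-eq₂ = ℕ-Solver.solve-∀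

      module _ {L : List V} (unique : Unique L) (c<#X : c < #X L) (#Y≡c : #Y L ≡ c) (1≤c : 1 ≤ c) where

        -- As `#Y L ≡ c`, this counts the Y-vertices of `L` not adjacent to `z`.
        gap : Fin n → ℕ
        gap z = c ∸ deg z L

        Σgap : List (Fin n) → ℕ
        Σgap Q = sum (map gap Q)

        deg+gap : ∀ z → deg z L + gap z ≡ c
        deg+gap z = m+[n∸m]≡n (≤-trans (deg≤#Y z L) (≤-reflexive #Y≡c))

        Σdeg+Σgap : ∀ Q → Σdeg L Q + Σgap Q ≡ length Q * c
        Σdeg+Σgap [] = refl
        Σdeg+Σgap (z ∷ Q) = trans (interchange (deg z L) _ _ _) (cong₂ _+_ (deg+gap z) (Σdeg+Σgap Q))

        -- Let t be the length of `T`, which is also the degree of `x` into `L`. Then `family₃` for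
        -- `x ∷ T` reads c + 5 + (t - 2)(c + 1) ≤ t + tc - Σgap T, which simplifies to the last
        -- bound.
        gap-family : ∀ {x} → Omits L x →
          ∃[ T ] (AllPairs (Linked L) T × length T ≡ deg x L × 2 ≤ length T × Σgap T + 3 ≤ c)
        gap-family {x} om@(K , C , σ , 2≤) with linkedFamily om
        ... | T , as@(_ ∷ ls) , eq = T , ls , eq , 2≤T , +-cancelˡ-≤ (Σdeg L T + (r * c + r + 2 + c)) _ _ (begin
              Σdeg L T + (r * c + r + 2 + c) + (Σgap T + 3)
                ≡⟨ eq₁ (Σdeg L T) r c (Σgap T) ⟩
              (Σdeg L T + Σgap T) + (c + 5 + r * suc c)
                ≡⟨ cong (_+ (c + 5 + r * suc c)) (Σdeg+Σgap T) ⟩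
              length T * c + (c + 5 + r * suc c)
                ≡⟨ cong₂ (λ t k → t * c + (k + 5 + r * suc c)) (sym lenT) (sym #Y≡c) ⟩
              (2 + r) * c + (#Y L + 5 + r * suc c)
                ≤⟨ +-monoʳ-≤ ((2 + r) * c) (family₃ r unique ds (cong suc (sym lenT))) ⟩
              (2 + r) * c + (deg x L + Σdeg L T)
                ≡⟨ cong (λ d → (2 + r) * c + (d + Σdeg L T)) (trans (sym eq) (sym lenT)) ⟩
              (2 + r) * c + (2 + r + Σdeg L T)
                ≡⟨ eq₂ (Σdeg L T) r c ⟩
              Σdeg L T + (r * c + r + 2 + c) + c ∎)
          where
          open ≤-Reasoning
          2≤T : 2 ≤ length T
          2≤T = subst (2 ≤_) (trans (count-↭ (inj₁ x ~?_) σ) (sym eq)) 2≤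
          r : ℕ
          r = length T ∸ 2
          lenT : 2 + r ≡ length T
          lenT = m+[n∸m]≡n 2≤T
          ds : AllPairs (Disj L) (x ∷ T)
          ds = AllPairs.map (Disj-ends unique c<#X) as
          eq₁ : ∀ D r c G → D + (r * c + r + 2 + c) + (G + 3) ≡ (D + G) + (c + 5 + r * suc c)
          eq₁ = ℕ-Solver.solve-∀
          eq₂ : ∀ D r c → (2 + r) * c + (2 + r + D) ≡ D + (r * c + r + 2 + c) + c
          eq₂ = ℕ-Solver.solve-∀

        record PairGap (s s′ : Fin n) : Set where
          constructor pairGap
          field
            zs      : List (Fin n)
            omits   : All (Omits L) zs
            lower   : c ≤ suc (length zs) + (gap s + gap s′)
            upper   : zs ≡ [] ⊎ Σgap zs + 3 ≤ c

        -- `lower` is the crossing count written with gaps. `upper` is `family₃` for `s`, `s′` and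
        -- the crossings, with the degrees of `s` and `s′` estimated by the same count; without a
        -- crossing there are only two vertices and nothing is claimed.
        pair-gap : ∀ {s s′} → Linked L s s′ → PairGap s s′
        pair-gap {s} {s′} l with path-crossings unique c<#X 1≤c l
        ... | pathCrossings zs om ds b = pairGap zs om lower (upper zs ds b′)
          where
          open ≤-Reasoning
          b′ : deg s L + deg s′ L ≤ suc c + length zs
          b′ = subst (λ k → deg s L + deg s′ L ≤ suc k + length zs) #Y≡c b
          lower : c ≤ suc (length zs) + (gap s + gap s′)
          lower = +-cancelˡ-≤ c _ _ (begin
            c + c                                              ≡⟨ cong₂ _+_ (deg+gap s) (deg+gap s′) ⟨
            (deg s L + gap s) + (deg s′ L + gap s′)            ≡⟨ interchange (deg s L) _ _ _ ⟩
            (deg s L + deg s′ L) + (gap s + gap s′)            ≤⟨ +-monoˡ-≤ _ b′ ⟩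
            (suc c + length zs) + (gap s + gap s′)             ≡⟨ eq₁ c (length zs) (gap s + gap s′) ⟩
            c + (suc (length zs) + (gap s + gap s′))           ∎)
            where
            eq₁ : ∀ c t g → (suc c + t) + g ≡ c + (suc t + g)
            eq₁ = ℕ-Solver.solve-∀
          upper : ∀ zs → AllPairs (Disj L) (s ∷ s′ ∷ zs) → deg s L + deg s′ L ≤ suc c + length zs →
                  zs ≡ [] ⊎ Σgap zs + 3 ≤ c
          upper [] _ _ = inj₁ refl
          upper zs@(z ∷ zs′) ds b = inj₂ (+-cancelˡ-≤ (Σdeg L zs + (r * c + r + 2 + c)) _ _ (begin
              Σdeg L zs + (r * c + r + 2 + c) + (Σgap zs + 3)
                ≡⟨ eq₁ (Σdeg L zs) r c (Σgap zs) ⟩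
              (Σdeg L zs + Σgap zs) + (c + 5 + r * suc c)
                ≡⟨ cong₂ (λ k y → k + (y + 5 + r * suc c)) (Σdeg+Σgap zs) (sym #Y≡c) ⟩
              (suc r) * c + (#Y L + 5 + r * suc c)
                ≤⟨ +-monoʳ-≤ ((suc r) * c) (family₃ r unique ds refl) ⟩
              (suc r) * c + (deg s L + (deg s′ L + Σdeg L zs))
                ≡⟨ cong (suc r * c +_) (+-assoc (deg s L) _ _) ⟨
              (suc r) * c + (deg s L + deg s′ L + Σdeg L zs)
                ≤⟨ +-monoʳ-≤ (suc r * c) (+-monoˡ-≤ (Σdeg L zs) b) ⟩
              (suc r) * c + (suc c + suc r + Σdeg L zs)
                ≡⟨ eq₂ (Σdeg L zs) r c ⟩
              Σdeg L zs + (r * c + r + 2 + c) + c ∎))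
            where
            r : ℕ
            r = length zs′
            eq₁ : ∀ D r c G → D + (r * c + r + 2 + c) + (G + 3) ≡ (D + G) + (c + 5 + r * suc c)
            eq₁ = ℕ-Solver.solve-∀
            eq₂ : ∀ D r c → suc r * c + (suc c + suc r + D) ≡ D + (r * c + r + 2 + c) + c
            eq₂ = ℕ-Solver.solve-∀

      -- No vertex off a longest cycle has two neighbours on it.

      module _ (1≤c : 1 ≤ c)
        (noCut : ∀ w u v → u ≢ w → v ≢ w → Star (λ u v → u ≢ w × v ≢ w × u ~ v) u v) where

        -- Since `deg z L ≤ c < δ`, some neighbour of `z` is off `L`, and a path from it that avoids
        -- `z` reaches `K` at some `q`. If `q` is in X, then `z` misses both neighbours of `q` on
        -- `K`. If `q` is in Y, this path brings in another X-vertex, so a detour may skip one on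
        -- `K`, and `z` misses the Y-vertices two places further on from the neighbours of `q` in
        -- Y-order. By `3 ≤ c` the two missed vertices are distinct.
        twoGaps : ∀ {L z} → Unique L → #X L ≡ suc c → 3 ≤ c → Omits L z → 2 + deg z L ≤ c
        twoGaps {L} {z} u eq 3≤c (K , C , σ , _) = subst (λ d → 2 + d ≤ c) (count-↭ (inj₁ z ~?_) σ)
            (≤-trans missing (≤-reflexive #YK))
          where
          open ≤-Reasoning
          #XK : #X K ≡ c
          #XK = suc-injective (trans (count-↭ isX? σ) eq)
          #YK : #Y K ≡ c
          #YK = trans (sym (#X≡#Y-cycle C)) #XK
          uzK : Unique (inj₁ z ∷ K)
          uzK = Unique-resp-↭ (↭-sym σ) u
          z∉K : inj₁ z ∉ K
          z∉K with uzK
          ... | z≢ ∷ _ = All≢⇒∉ z≢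
          uK : Unique K
          uK with uzK
          ... | _ ∷ uK = uK

          module WithHit {y : Fin m} (z∈y : z ∈ₛ edge y) {h q : V} {D : List V}
            (p : Path (inj₂ y) h D) (uD : Unique D) (out : All (_∉ K) D) (z∉D : inj₁ z ∉ D)
            (h~q : h ~ q) where

            uAll : Unique (K ++ inj₁ z ∷ D)
            uAll = Uniqueₚ.++⁺ uK (∉⇒All≢ z∉D ∷ uD)
              λ { (v∈K , here refl) → z∉K v∈K ; (v∈K , there v∈D) → All.lookup out v∈D v∈K }

            -- If `z` were adjacent to `r`, the cycle r ... q h ... y z r, which leaves out only the
            -- part `N` of `K`, would be too long.
            avoid : ∀ {r M N} → Pth (inj₂ r) q M → N ++ M ↭ K → c < #X M + suc (#X D) → ¬ z ∈ₛ edge r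
            avoid {r} {M} {N} P τ c<′ z∈r = tooLong (Unique-++⁻ˡ (M ++ inj₁ z ∷ D) (Unique-resp-↭ ρ uAll))
                (subst (c <_) (sym (count-++ isX? M (inj₁ z ∷ D))) c<′)
                (cyc (reorder (++⁺ˡ M (++-comm D (inj₁ z ∷ [])))
                  (P ⟨ ~-sym {h} h~q ⟩ rev (fromPath p) ⟨ z∈y ⟩ pt (inj₁ z))) z∈r)
              where
              ρ : K ++ inj₁ z ∷ D ↭ (M ++ inj₁ z ∷ D) ++ N
              ρ = ↭-trans (++⁺ (↭-sym τ) ↭-refl)
                    (solve 3 (λ M N D → ((N ⊕ M) ⊕ D) ⊜ ((M ⊕ D) ⊕ N)) ↭-refl M N (inj₁ z ∷ D))

          missing : 2 + deg z K ≤ #Y K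
          missing with freshNeighbour L z (≤-<-trans (deg≤#Y z L) (≤-<-trans (≤-reflexive (trans (sym (count-↭ isY? σ)) #YK)) c<δ))
          ... | y , y∉L , z∈y with firstHit {S = K} {w = inj₁ z} (noCut (inj₁ z) (inj₂ y) (Cycle.from C) (λ ())
                    (λ t≡z → z∉K (subst (_∈ K) t≡z t∈K)))
                    (λ y∈ → y∉L (∈-resp-↭ σ (there y∈))) t∈K
            where
            t∈K : Cycle.from C ∈ K
            t∈K = first∈ (Cycle.path C)
          ... | hit {h} {inj₁ q} {D} p uD out z∉D h~q q∈K _ = nearX
            where
            open WithHit z∈y {q = inj₁ q} p uD out z∉D h~q
            long : ∀ {M} → M ↭ K → c < #X M + suc (#X D)
            long {M} σ = begin-strict
              c                   <⟨ m<m+n c (s≤s z≤n) ⟩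
              c + suc (#X D)      ≡⟨ cong (_+ suc (#X D)) (trans (count-↭ isX? σ) #XK) ⟨
              #X M + suc (#X D)   ∎
            nearX : 2 + deg z K ≤ #Y K
            nearX with rotate C q∈K
            ... | inj₂ r , P , q~r with mkUnsnoc (λ ()) P
            ... | unsnoc {inj₂ b} (pth [ _ ] τ) b~q ρ =
                  ⊥-elim (<⇒≱ 3≤c (≤-trans (≤-reflexive (sym (trans (trans (cong suc (count-↭ isX? τ)) (count-↭ isX? ρ)) #XK))) (s≤s z≤n)))
            ... | unsnoc {inj₂ b} {R} (pth (_∷_ {L = M} e B) τ) b~q ρ =
                  deg-missing₂ {M = inj₁ q ∷ M} (↭-trans (swap _ _ ↭-refl) (↭-trans (↭-prep _ τ) ρ))
                    (there (end∈ B))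
                    (avoid {N = []} P ↭-refl (long ↭-refl))
                    (avoid {N = []} (rev (pth (e ∷ B) τ) ⟨ q~r ⟩ pt (inj₁ q)) ρ′ (long ρ′))
              where
              ρ′ : R ++ inj₁ q ∷ [] ↭ K
              ρ′ = ↭-trans (++-comm R _) ρ
          ... | hit {inj₁ h} {inj₂ q} {D} p uD out z∉D h~q q∈K _ = nearY
            where
            open WithHit z∈y {q = inj₂ q} p uD out z∉D h~q
            long : ∀ {M b} → inj₁ b ∷ M ↭ K → c < #X M + suc (#X D)
            long {M} σ = begin-strict
              c                      ≡⟨ trans (count-↭ isX? σ) #XK ⟨
              suc (#X M)             <⟨ s≤s (m<m+n (#X M) (#X-∈ (end∈ p))) ⟩
              suc (#X M + #X D)      ≡⟨ +-suc (#X M) (#X D) ⟨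
              #X M + suc (#X D)      ∎
            nearY : 2 + deg z K ≤ #Y K
            nearY with rotate C q∈K
            ... | inj₁ a , P , q~a with mkUnsnoc (λ ()) P
            ... | unsnoc {inj₁ b} (pth [ _ ] τ) b~q ρ = ⊥-elim (<⇒≱ 3≤c (≤-trans
                    (≤-reflexive (trans (sym #XK) (count-↭ isX? (↭-trans (↭-sym ρ) (↭-prep _ (↭-sym τ))))))
                    (s≤s z≤n)))
            ... | unsnoc {inj₁ b} (pth (_∷_ {b = inj₂ _} _ (_ ∷ [ _ ])) τ) b~q ρ = ⊥-elim (<⇒≱ 3≤c
                    (≤-reflexive (trans (sym #XK) (count-↭ isX? (↭-trans (↭-sym ρ) (↭-prep _ (↭-sym τ)))))))
            ... | unsnoc {inj₁ b} (pth (_∷_ {b = inj₂ a₂} e₁ (_∷_ {b = inj₁ a₃} e₂ (_∷_ {b = inj₂ a₄} {L = M} e₃ Q))) τ) b~q ρ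
                with mkUnsnoc (λ ()) (fromPath Q)
            ... | unsnoc {inj₂ b₂} {R} S b₂~b υ =
                  deg-missing₂ {M = inj₁ a₃ ∷ inj₂ q ∷ inj₁ a ∷ M}
                    (↭-trans (solve 5 (λ a₂ a₃ q a M → (a₂ ⊕ a₃ ⊕ q ⊕ a ⊕ M) ⊜ (q ⊕ a ⊕ a₂ ⊕ a₃ ⊕ M)) ↭-refl
                      (inj₂ a₂ ∷ []) (inj₁ a₃ ∷ []) (inj₂ q ∷ []) (inj₁ a ∷ []) M) κ)
                    (there (there (there (∈-resp-↭ υ (there (last∈ S))))))
                    (avoid {N = inj₁ a ∷ []}
                      (pt (inj₂ a₂) ⟨ e₂ ⟩ pt (inj₁ a₃) ⟨ e₃ ⟩ fromPath Q ⟨ b~q ⟩ pt (inj₂ q)) σ₁ (long σ₁))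
                    (avoid {N = inj₁ b ∷ []}
                      (rev S ⟨ e₃ ⟩ pt (inj₁ a₃) ⟨ e₂ ⟩ pt (inj₂ a₂)
                        ⟨ e₁ ⟩ pt (inj₁ a) ⟨ q~a ⟩ pt (inj₂ q)) σ₂ (long σ₂))
              where
              κ : inj₂ q ∷ inj₁ a ∷ inj₂ a₂ ∷ inj₁ a₃ ∷ M ↭ K
              κ = ↭-trans (↭-prep _ τ) ρ
              σ₁ : inj₁ a ∷ inj₂ a₂ ∷ inj₁ a₃ ∷ M ++ inj₂ q ∷ [] ↭ K
              σ₁ = ↭-trans (++-comm (inj₁ a ∷ inj₂ a₂ ∷ inj₁ a₃ ∷ M) _) κ
              σ₂ : inj₁ b ∷ R ++ inj₁ a₃ ∷ inj₂ a₂ ∷ inj₁ a ∷ inj₂ q ∷ [] ↭ K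
              σ₂ = ↭-trans (solve 5 (λ a₂ a₃ q a M → (M ⊕ a₃ ⊕ a₂ ⊕ a ⊕ q) ⊜ (q ⊕ a ⊕ a₂ ⊕ a₃ ⊕ M)) ↭-refl
                      (inj₂ a₂ ∷ []) (inj₁ a₃ ∷ []) (inj₂ q ∷ []) (inj₁ a ∷ []) (inj₁ b ∷ R))
                     (↭-trans (++⁺ˡ (inj₂ q ∷ inj₁ a ∷ inj₂ a₂ ∷ inj₁ a₃ ∷ []) υ) κ)

        omits-impossible : ∀ {L x} → Unique L → #X L ≡ suc c → ¬ Omits L x
        omits-impossible {L} {x} unique #X≡ om@(K , C , σ , _) = step₂ om
          where
          c<#X : c < #X L
          c<#X = ≤-reflexive (sym #X≡)
          #Y≡c : #Y L ≡ c
          #Y≡c = trans (sym (count-↭ isY? σ))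
                   (trans (sym (#X≡#Y-cycle C)) (suc-injective (trans (count-↭ isX? σ) #X≡)))
          g : Fin n → ℕ
          g = gap unique c<#X #Y≡c 1≤c
          Σg : List (Fin n) → ℕ
          Σg = Σgap unique c<#X #Y≡c 1≤c
          fam = gap-family unique c<#X #Y≡c 1≤c
          pair = pair-gap unique c<#X #Y≡c 1≤c
          3≤c : 3 ≤ c
          3≤c with fam om
          ... | _ , _ , _ , _ , le = ≤-trans (m≤n+m 3 _) le

          2≤g : ∀ {z} → Omits L z → 2 ≤ g z
          2≤g om = m+n≤o⇒m≤o∸n 2 (twoGaps unique #X≡ 3≤c om)

          Σg-lower : ∀ {k zs} → All (λ z → k ≤ g z) zs → length zs * k ≤ Σg zs
          Σg-lower [] = z≤n
          Σg-lower (p ∷ ps) = +-mono-≤ p (Σg-lower ps)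

          -- Put G = g s + g s′. With t > 0 crossings, `2≤g` and `upper` give 2t ≤ c - 3, and twice
          -- `lower` is 2c ≤ 2 + 2t + 2G. Without crossings 2c ≤ 2 + 2G, and `3 ≤ c` suffices.
          pair-lower : ∀ {s s′} → Linked L s s′ → suc c ≤ (g s + g s′) + (g s + g s′)
          pair-lower {s} {s′} l with pair l
          ... | pairGap .[] _ lower (inj₁ refl) = +-cancelˡ-≤ 2 _ _ (begin
              3 + c                   ≤⟨ +-monoˡ-≤ c 3≤c ⟩
              c + c                   ≤⟨ +-mono-≤ lower lower ⟩
              suc G + suc G           ≡⟨ cong suc (+-suc G G) ⟩
              2 + (G + G)             ∎)
            where
            open ≤-Reasoning
            G = g s + g s′
          ... | pairGap zs oms lower (inj₂ upper) = +-cancelˡ-≤ (2 * t + c + 2) _ _ (begin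
              2 * t + c + 2 + suc c     ≡⟨ eq₁ t c ⟩
              (t * 2 + 3) + (c + c)     ≤⟨ +-mono-≤ (≤-trans (+-monoˡ-≤ 3 (Σg-lower (All.map 2≤g oms))) upper) (+-mono-≤ lower lower) ⟩
              c + ((suc t + G) + (suc t + G)) ≡⟨ eq₂ t c G ⟩
              2 * t + c + 2 + (G + G)   ∎)
            where
            open ≤-Reasoning
            G = g s + g s′
            t = length zs
            eq₁ : ∀ t c → 2 * t + c + 2 + suc c ≡ (t * 2 + 3) + (c + c)
            eq₁ = ℕ-Solver.solve-∀
            eq₂ : ∀ t c G → c + ((suc t + G) + (suc t + G)) ≡ 2 * t + c + 2 + (G + G)
            eq₂ = ℕ-Solver.solve-∀

          step₁ : ∀ {z} → Omits L z → deg z L ≤ 3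
          step₁ om′ with fam om′
          ... | [] , _ , eq , _ = ≤-trans (≤-reflexive (sym eq)) z≤n
          ... | _ ∷ [] , _ , eq , _ = ≤-trans (≤-reflexive (sym eq)) (s≤s z≤n)
          ... | _ ∷ _ ∷ [] , _ , eq , _ = ≤-trans (≤-reflexive (sym eq)) (s≤s (s≤s z≤n))
          ... | _ ∷ _ ∷ _ ∷ [] , _ , eq , _ = ≤-reflexive (sym eq)
          -- Four predecessors contain two disjoint linked pairs. By `pair-lower` their gaps sum to
          -- at least c + 1, but `gap-family` allows at most c - 3.
          ... | a ∷ b ∷ d ∷ e ∷ T , (l ∷ _) ∷ _ ∷ (l′ ∷ _) ∷ _ , _ , _ , le =
                ⊥-elim (<⇒≱ (+-mono-≤ (pair-lower l) (pair-lower l′)) (begin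
                  (A + A) + (B + B)                  ≤⟨ m≤m+n _ (R + R + 6) ⟩
                  (A + A) + (B + B) + (R + R + 6)    ≡⟨ eq₁ (g a) (g b) (g d) (g e) R ⟩
                  (S + 3) + (S + 3)                  ≤⟨ +-mono-≤ le le ⟩
                  c + c                              ≤⟨ +-monoʳ-≤ c (n≤1+n c) ⟩
                  c + suc c                          ∎))
            where
            open ≤-Reasoning
            A = g a + g b
            B = g d + g e
            R = Σg T
            S = g a + (g b + (g d + (g e + R)))
            eq₁ : ∀ a b d e r → ((a + b) + (a + b)) + ((d + e) + (d + e)) + (r + r + 6)
                  ≡ (a + (b + (d + (e + r))) + 3) + (a + (b + (d + (e + r))) + 3)
            eq₁ = ℕ-Solver.solve-∀

          step₂ : ∀ {z} → Omits L z → ⊥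
          step₂ om′ with fam om′
          ... | [] , _ , _ , () , _
          ... | _ ∷ [] , _ , _ , s≤s () , _
          ... | a ∷ b ∷ T , (l ∷ _) ∷ _ , _ , _ , le = few (pair l)
            where
            open ≤-Reasoning
            G+3≤c : (g a + g b) + 3 ≤ c
            G+3≤c = ≤-trans (+-monoˡ-≤ 3 (≤-trans (m≤m+n _ (Σg T)) (≤-reflexive (+-assoc (g a) _ _)))) le
            -- Since g a + g b ≤ c - 3, `lower` demands at least two crossings.
            notFew : ∀ {t} → t ≤ 1 → ¬ c ≤ suc t + (g a + g b)
            notFew {t} t≤1 lower = <⇒≱ (n<1+n c) (begin
              suc c                     ≤⟨ s≤s lower ⟩
              suc (suc t + (g a + g b)) ≤⟨ s≤s (+-monoˡ-≤ _ (s≤s t≤1)) ⟩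
              3 + (g a + g b)           ≡⟨ +-comm 3 _ ⟩
              (g a + g b) + 3           ≤⟨ G+3≤c ⟩
              c                         ∎)
            few : PairGap unique c<#X #Y≡c 1≤c a b → ⊥
            few (pairGap .[] _ lower (inj₁ refl)) = notFew z≤n lower
            few (pairGap [] _ lower (inj₂ _)) = notFew z≤n lower
            few (pairGap (_ ∷ []) _ lower (inj₂ _)) = notFew ≤-refl lower
            -- By `step₁` each crossing has gap at least k = c - 3, while all of them together have
            -- at most k. Two crossings force k = 0, but already one has gap at least 2.
            few (pairGap zs@(z ∷ z′ ∷ zs′) oms@(o ∷ o′ ∷ _) lower (inj₂ upper)) = <⇒≱ k>0 k≤0
              where
              k = c ∸ 3
              Σ≤k : Σg zs ≤ k
              Σ≤k = m+n≤o⇒m≤o∸n (Σg zs) upper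
              k>0 : 0 < k
              k>0 = ≤-trans (≤-trans (s≤s z≤n) (≤-trans (2≤g o) (m≤m+n _ _))) Σ≤k
              k≤g : ∀ {v} → Omits L v → k ≤ g v
              k≤g om = ∸-monoʳ-≤ c (step₁ om)
              k≤0 : k ≤ 0
              k≤0 = +-cancelˡ-≤ k _ _ (begin
                k + k               ≤⟨ +-mono-≤ (k≤g o) (k≤g o′) ⟩
                g z + g z′          ≤⟨ m≤m+n _ (Σg zs′) ⟩
                g z + g z′ + Σg zs′ ≡⟨ +-assoc (g z) _ _ ⟩
                Σg zs               ≤⟨ Σ≤k ⟩
                k                   ≡⟨ +-identityʳ k ⟨
                k + 0               ∎)

-- Excluding ears of a longest cycle.

module Ears {n m c δ : ℕ} (H : Hypergraph n m)
  (minDegree : Hypergraph.MinDegree≥ H δ) (m+5≤3δ : m + 5 ≤ 3 * δ) (c<δ : c < δ) (1≤c : 1 ≤ c)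
  (noCut : ∀ w → Graph.ConnectedWithout (Hypergraph.incidenceGraph H) w)
  (longest : ∀ {L} → Bipartite.Cycle H L → Unique L → Bipartite.#X H L ≤ c) where

  open Hypergraph H
  open Bipartite H
  open Longest longest
  open Counting minDegree m+5≤3δ c<δ

  -- The longest cycle runs u … xₖ yₖ k′ … e y₀, and an ear runs e y° x₁ … xₚ y°° xₖ.
  -- The vertex y° is y₀ or lies off the cycle, and y°° is yₖ or lies off the cycle.
  module _ {u xₖ k′ e x₁ : Fin n} {yₖ y₀ y° y°° : Fin m} {A B : List V}
    (pA : Pth (inj₁ u) (inj₁ xₖ) A) (pB : Pth (inj₁ k′) (inj₁ e) B)
    (xₖ∈yₖ : xₖ ∈ₛ edge yₖ) (k′∈yₖ : k′ ∈ₛ edge yₖ) (u∈y₀ : u ∈ₛ edge y₀) (e∈y₀ : e ∈ₛ edge y₀)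
    (e∈y° : e ∈ₛ edge y°) (x₁∈y° : x₁ ∈ₛ edge y°) (xₖ∈y°° : xₖ ∈ₛ edge y°°)
    (y°≢y°° : y° ≢ y°°) (y°≢yₖ : y° ≢ yₖ) (y°°≢y₀ : y°° ≢ y₀) (#X≡c : #X (A ++ B) ≡ c) where

    C : List V
    C = inj₂ yₖ ∷ inj₂ y₀ ∷ A ++ B

    cycleC : Cycle C
    cycleC = cyc (reorder (solve 4 (λ a k b o → (a ⊕ k ⊕ b ⊕ o) ⊜ (k ⊕ o ⊕ a ⊕ b)) ↭-refl
                    A (inj₂ yₖ ∷ []) B (inj₂ y₀ ∷ []))
               (pA ⟨ xₖ∈yₖ ⟩ pt (inj₂ yₖ) ⟨ k′∈yₖ ⟩ pB ⟨ e∈y₀ ⟩ pt (inj₂ y₀))) u∈y₀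

    -- `y°` and `y°°` may lie on `C`, as `y₀` and `yₖ`, so they are kept out of `A`, `B` and `D`
    -- only.
    record Fits (D : List V) : Set where
      constructor fits
      field
        unique : Unique (C ++ D)
        y°∉    : inj₂ y° ∉ (A ++ B) ++ D
        y°°∉   : inj₂ y°° ∉ (A ++ B) ++ D

    Fits-⊆ : ∀ {D D′ R} → D ↭ D′ ++ R → Fits D → Fits D′
    Fits-⊆ {D} {D′} {R} σ (fits uq ∉₁ ∉₂) = fits
        (Unique-++⁻ˡ (C ++ D′) (Unique-resp-↭ (↭-trans (++⁺ˡ C σ) (↭-reflexive (sym (++-assoc C D′ R)))) uq))
        (∉₁ ∘ sub) (∉₂ ∘ sub)
      where
      sub : ∀ {v} → v ∈ (A ++ B) ++ D′ → v ∈ (A ++ B) ++ D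
      sub v∈ = ∈-resp-↭ (↭-trans (↭-reflexive (++-assoc (A ++ B) D′ R)) (++⁺ˡ (A ++ B) (↭-sym σ))) (∈-++⁺ˡ v∈)

    inj₂≢ : ∀ {y y′} → y ≢ y′ → inj₂ y ≢ (V ∋ inj₂ y′)
    inj₂≢ y≢ refl = y≢ refl

    module _ {D : List V} {xₚ : Fin n} (pD : Path (inj₁ x₁) (inj₁ xₚ) D) (xₚ∈y°° : xₚ ∈ₛ edge y°°)
      (f : Fits D) where
      open Fits f

      P : List V
      P = A ++ inj₂ y°° ∷ D ++ inj₂ y° ∷ B

      P↭ : P ↭ inj₂ y° ∷ inj₂ y°° ∷ (A ++ B) ++ D
      P↭ = solve 5 (λ a b d s t → (a ⊕ t ⊕ d ⊕ s ⊕ b) ⊜ (s ⊕ t ⊕ (a ⊕ b) ⊕ d)) ↭-refl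
             A B D (inj₂ y° ∷ []) (inj₂ y°° ∷ [])

      uABD : Unique ((A ++ B) ++ D)
      uABD with unique
      ... | _ ∷ _ ∷ w = w

      uP : Unique P
      uP = Unique-resp-↭ (↭-sym P↭)
             ((inj₂≢ y°≢y°° ∷ ∉⇒All≢ y°∉) ∷ ∉⇒All≢ y°°∉ ∷ uABD)

      -- The ear bridges two cuts of the cycle: u ... xₖ, then the ear backwards, then e ... k′.
      pathP : Pth (inj₁ u) (inj₁ k′) P
      pathP = pA ⟨ xₖ∈y°° ⟩ pt (inj₂ y°°) ⟨ xₚ∈y°° ⟩ rev (fromPath pD) ⟨ x₁∈y° ⟩ pt (inj₂ y°) ⟨ e∈y° ⟩ rev pB

      #XD>0 : 1 ≤ #X D
      #XD>0 = #X-∈ (first∈ (fromPath pD))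

      #XP : #X P ≡ c + #X D
      #XP = trans (count-↭ isX? P↭) (trans (count-++ isX? (A ++ B) D) (cong (_+ #X D) #X≡c))

      c<#XP : c < #X P
      c<#XP = <-≤-trans (m<m+n c #XD>0) (≤-reflexive (sym #XP))

      -- The cycle left by a crossing has one X-vertex fewer than `P`. It is too long unless `P` has
      -- exactly c + 1 of them, and then `omits-impossible` applies.
      noCrossing : ∀ {z} → ¬ Omits P z
      noCrossing om@(K , CK , σ , _) with m≤n⇒m<n∨m≡n c<#XP
      ... | inj₂ eq = omits-impossible 1≤c noCut uP (sym eq) om
      ... | inj₁ lt with Unique-resp-↭ (↭-sym σ) uP
      ... | _ ∷ uK = tooLong uK (≤-pred (subst (suc c <_) (sym (count-↭ isX? σ)) lt)) CK

      ends : Disj P u k′ × deg u P + deg k′ P ≤ suc (#Y P)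
      ends with path-crossings uP c<#XP 1≤c pathP
      ... | pathCrossings [] _ ((d ∷ []) ∷ _) b = d , ≤-trans b (≤-reflexive (+-identityʳ _))
      ... | pathCrossings (_ ∷ _) (om ∷ _) _ _ = ⊥-elim (noCrossing om)

      D≡ : ∃[ M ] (D ≡ inj₁ x₁ ∷ M)
      D≡ = startsWith pD

      uC[x₁] : Unique (C ++ inj₁ x₁ ∷ [])
      uC[x₁] = Fits.unique (Fits-⊆ {D′ = inj₁ x₁ ∷ []} {R = proj₁ D≡} (↭-reflexive (proj₂ D≡)) f)

      ∉[x₁] : ∀ {y} → inj₂ y ∉ (A ++ B) ++ D → inj₂ y ∉ (A ++ B) ++ inj₁ x₁ ∷ []
      ∉[x₁] y∉ y∈ with ∈-++⁻ (A ++ B) y∈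
      ... | inj₁ y∈AB = y∉ (∈-++⁺ˡ y∈AB)
      ... | inj₂ (here ())

      #XC+ : ∀ M → 1 ≤ #X M → c < #X ((A ++ B) ++ M)
      #XC+ M 1≤ = <-≤-trans (m<m+n c 1≤)
        (≤-reflexive (sym (trans (count-++ isX? (A ++ B) M) (cong (_+ #X M) #X≡c))))

      ∈P : ∀ {v} → v ∈ inj₂ y° ∷ inj₂ y°° ∷ (A ++ B) ++ D → v ∈ P
      ∈P = ∈-resp-↭ (↭-sym P↭)

      ∉C+ : ∀ {y} M → y ≢ yₖ → y ≢ y₀ → inj₂ y ∉ (A ++ B) ++ M → All (inj₂ y ≢_) (C ++ M)
      ∉C+ M ≢k ≢0 y∉ = inj₂≢ ≢k ∷ inj₂≢ ≢0 ∷ ∉⇒All≢ y∉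

      -- A common neighbour `yₖ` gives the cycle u ... xₖ y°° xₚ ... x₁ yₖ k′ ... e y₀ u. Any other
      -- `y` off `P` gives u ... xₖ yₖ k′ ... e y° x₁ y u.
      disj-u : Disj P u x₁
      disj-u y y∉P u∈y x₁∈y with y Fin.≟ yₖ
      ... | yes refl = tooLong
              (∉C+ D (λ { refl → y∉P (∈P (there (here refl))) }) y°°≢y₀ y°°∉ ∷ unique)
              (#XC+ D #XD>0)
              (cyc (reorder (solve 6 (λ a t d k b o → (a ⊕ t ⊕ d ⊕ k ⊕ b ⊕ o) ⊜ (t ⊕ k ⊕ o ⊕ (a ⊕ b) ⊕ d)) ↭-refl
                     A (inj₂ y°° ∷ []) D (inj₂ yₖ ∷ []) B (inj₂ y₀ ∷ []))
                 (pA ⟨ xₖ∈y°° ⟩ pt (inj₂ y°°) ⟨ xₚ∈y°° ⟩ rev (fromPath pD) ⟨ x₁∈y ⟩ pt (inj₂ yₖ)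
                   ⟨ k′∈yₖ ⟩ pB ⟨ e∈y₀ ⟩ pt (inj₂ y₀))) u∈y₀)
      ... | no y≢yₖ = tooLong
              ((inj₂≢ (λ { refl → y∉P (∈P (here refl)) }) ∷ inj₂≢ y≢yₖ ∷ ∉⇒All≢ (∉[x₁] (y∉P ∘ ∈P ∘ there ∘ there)))
                ∷ (inj₂≢ y°≢yₖ ∷ ∉⇒All≢ (∉[x₁] y°∉)) ∷ drop₂ uC[x₁])
              (#XC+ (inj₁ x₁ ∷ []) ≤-refl)
              (cyc (reorder (solve 6 (λ a k b s x y → (a ⊕ k ⊕ b ⊕ s ⊕ x ⊕ y) ⊜ (y ⊕ s ⊕ k ⊕ (a ⊕ b) ⊕ x)) ↭-refl
                     A (inj₂ yₖ ∷ []) B (inj₂ y° ∷ []) (inj₁ x₁ ∷ []) (inj₂ y ∷ []))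
                 (pA ⟨ xₖ∈yₖ ⟩ pt (inj₂ yₖ) ⟨ k′∈yₖ ⟩ pB ⟨ e∈y° ⟩ pt (inj₂ y°) ⟨ x₁∈y° ⟩ pt (inj₁ x₁)
                   ⟨ x₁∈y ⟩ pt (inj₂ y))) u∈y)
        where
        drop₂ : ∀ {a b : V} {M} → Unique (a ∷ b ∷ M) → Unique (a ∷ M)
        drop₂ ((_ ∷ p) ∷ _ ∷ q) = p ∷ q

      -- A common neighbour `y₀` lets y° x₁ be inserted between `e` and `y₀`. Any other `y` off `P`
      -- gives k′ ... e y₀ u ... xₖ y°° xₚ ... x₁ y k′.
      disj-k′ : Disj P k′ x₁
      disj-k′ y y∉P k′∈y x₁∈y with y Fin.≟ y₀
      ... | yes refl = tooLong
              (∉C+ (inj₁ x₁ ∷ []) y°≢yₖ (λ { refl → y∉P (∈P (here refl)) }) (∉[x₁] y°∉) ∷ uC[x₁])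
              (#XC+ (inj₁ x₁ ∷ []) ≤-refl)
              (cyc (reorder (solve 6 (λ a k b s x o → (a ⊕ k ⊕ b ⊕ s ⊕ x ⊕ o) ⊜ (s ⊕ k ⊕ o ⊕ (a ⊕ b) ⊕ x)) ↭-refl
                     A (inj₂ yₖ ∷ []) B (inj₂ y° ∷ []) (inj₁ x₁ ∷ []) (inj₂ y₀ ∷ []))
                 (pA ⟨ xₖ∈yₖ ⟩ pt (inj₂ yₖ) ⟨ k′∈yₖ ⟩ pB ⟨ e∈y° ⟩ pt (inj₂ y°) ⟨ x₁∈y° ⟩ pt (inj₁ x₁)
                   ⟨ x₁∈y ⟩ pt (inj₂ y₀))) u∈y₀)
      ... | no y≢y₀ = tooLong
              ((inj₂≢ (λ { refl → y∉P (∈P (there (here refl))) }) ∷ inj₂≢ y≢y₀ ∷ ∉⇒All≢ (y∉P ∘ ∈P ∘ there ∘ there))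
                ∷ (inj₂≢ y°°≢y₀ ∷ ∉⇒All≢ y°°∉) ∷ AllPairs.tail unique)
              (#XC+ D #XD>0)
              (cyc (reorder (solve 6 (λ b o a t d y → (b ⊕ o ⊕ a ⊕ t ⊕ d ⊕ y) ⊜ (y ⊕ t ⊕ o ⊕ (a ⊕ b) ⊕ d)) ↭-refl
                     B (inj₂ y₀ ∷ []) A (inj₂ y°° ∷ []) D (inj₂ y ∷ []))
                 (pB ⟨ e∈y₀ ⟩ pt (inj₂ y₀) ⟨ u∈y₀ ⟩ pA ⟨ xₖ∈y°° ⟩ pt (inj₂ y°°) ⟨ xₚ∈y°° ⟩ rev (fromPath pD)
                   ⟨ x₁∈y ⟩ pt (inj₂ y))) k′∈y)

      deg-AB : deg x₁ (A ++ B) ≤ 1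
      deg-AB = ≮⇒≥ λ 2≤ → omits-impossible 1≤c noCut (Unique-resp-↭ (++-comm C _) uC[x₁]) (cong suc #X≡c)
        (C , cycleC , ↭-refl , ≤-trans 2≤ AB≤C)
        where
        AB≤C : deg x₁ (A ++ B) ≤ deg x₁ C
        AB≤C = subst (deg x₁ (A ++ B) ≤_)
          (sym (count-++ (inj₁ x₁ ~?_) (inj₂ yₖ ∷ inj₂ y₀ ∷ []) (A ++ B))) (m≤n+m _ _)

      degP : deg x₁ P ≡ deg x₁ (inj₂ y° ∷ []) + (deg x₁ (inj₂ y°° ∷ []) + (deg x₁ (A ++ B) + deg x₁ D))
      degP = trans (count-↭ (inj₁ x₁ ~?_) P↭)
        (trans (count-++ (inj₁ x₁ ~?_) (inj₂ y° ∷ []) _)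
          (cong (deg x₁ (inj₂ y° ∷ []) +_) (trans (count-++ (inj₁ x₁ ~?_) (inj₂ y°° ∷ []) _)
            (cong (deg x₁ (inj₂ y°° ∷ []) +_) (count-++ (inj₁ x₁ ~?_) (A ++ B) D)))))

      deg-y≤1 : ∀ y → deg x₁ (inj₂ y ∷ []) ≤ 1
      deg-y≤1 y = deg≤#Y x₁ (inj₂ y ∷ [])

      -- `x₁` has at most 3 neighbours on `P`: `y°`, one in `A ++ B`, and one among `y°°` and `D`.
      -- With `ends`, the degrees of `x₁`, `u` and `k′` sum to at most #Y P + 4, one less than
      -- `family₃` requires.
      few-neighbours : deg x₁ (inj₂ y°° ∷ []) + deg x₁ D ≤ 1 → ⊥
      few-neighbours le = <⇒≱ (begin-strict
          deg x₁ P + (deg u P + (deg k′ P + 0))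
            ≡⟨ cong (deg x₁ P +_) (trans (sym (+-assoc (deg u P) _ _)) (+-identityʳ _)) ⟩
          deg x₁ P + (deg u P + deg k′ P)
            ≤⟨ +-mono-≤ deg≤3 (proj₂ ends) ⟩
          3 + suc (#Y P)
            ≡⟨ +-comm 4 (#Y P) ⟩
          #Y P + 4
            <⟨ +-monoʳ-< (#Y P) ≤-refl ⟩
          #Y P + 5
            ≡⟨ +-identityʳ _ ⟨
          #Y P + 5 + 0 ∎)
          (family₃ 0 uP ((disj-sym disj-u ∷ disj-sym disj-k′ ∷ []) ∷ (proj₁ ends ∷ []) ∷ [] ∷ []) refl)
        where
        open ≤-Reasoning
        disj-sym : ∀ {x x′} → Disj P x x′ → Disj P x′ x
        disj-sym d y y∉ p q = d y y∉ q p
        deg≤3 : deg x₁ P ≤ 3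
        deg≤3 = begin
          deg x₁ P
            ≡⟨ degP ⟩
          deg x₁ (inj₂ y° ∷ []) + (deg x₁ (inj₂ y°° ∷ []) + (deg x₁ (A ++ B) + deg x₁ D))
            ≡⟨ eq (deg x₁ (inj₂ y° ∷ [])) (deg x₁ (inj₂ y°° ∷ [])) (deg x₁ (A ++ B)) (deg x₁ D) ⟩
          deg x₁ (inj₂ y° ∷ []) + (deg x₁ (A ++ B) + (deg x₁ (inj₂ y°° ∷ []) + deg x₁ D))
            ≤⟨ +-mono-≤ (deg-y≤1 y°) (+-mono-≤ deg-AB le) ⟩
          3 ∎
          where
          eq : ∀ a b c d → a + (b + (c + d)) ≡ a + (c + (b + d))
          eq = ℕ-Solver.solve-∀

    -- A further neighbour of x₁ on the ear gives a shorter ear.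
    noEar : ∀ k {D xₚ} → length D ≤ k → Path (inj₁ x₁) (inj₁ xₚ) D → xₚ ∈ₛ edge y°° → Fits D → ⊥
    noEar k _ [ _ ] xₚ∈ f = few-neighbours [ _ ] xₚ∈ f
      (≤-trans (≤-reflexive (+-identityʳ _)) (deg≤#Y x₁ (inj₂ y°° ∷ [])))
    noEar (suc k) (s≤s le) p@(_∷_ {b = inj₂ y₁} e₁ q@(_∷_ {L = M} e₂ r)) xₚ∈ f with x₁ ∈ₛ? edge y°°
    ... | yes x₁∈ = noEar k (≤-trans (s≤s z≤n) le) [ _ ] x₁∈ (Fits-⊆ ↭-refl f)
    ... | no x₁∉ with 1 ≤? deg x₁ M
    ...   | no ¬1≤ = few-neighbours p xₚ∈ f (begin
                deg x₁ (inj₂ y°° ∷ []) + deg x₁ (inj₂ y₁ ∷ M)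
                  ≡⟨ cong₂ _+_ (deg-nonadj [] x₁∉) (deg-adj M e₁) ⟩
                suc (deg x₁ M)
                  ≤⟨ ≰⇒> ¬1≤ ⟩
                1 ∎)
      where open ≤-Reasoning
    ...   | yes 1≤ with neighbour∈ M 1≤
    ...     | y , y∈ , x₁∈y with suffixFrom r y∈
    ...       | N , M′ , s , refl = noEar k
                  (≤-trans (s≤s (≤-trans (m≤n+m (length M′) (length N)) (≤-reflexive (sym (length-++ N))))) le)
                  (_∷_ {b = inj₂ y} x₁∈y s) xₚ∈
                  (Fits-⊆ {R = inj₂ y₁ ∷ N} (solve 4 (λ x y n m → (x ⊕ y ⊕ n ⊕ m) ⊜ (x ⊕ m ⊕ y ⊕ n)) ↭-refl
                     (inj₁ x₁ ∷ []) (inj₂ y₁ ∷ []) N M′) f)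

  -- Existence and normal form of ears.

  module _ {K : List V} (cycleK : Cycle K) (uK : Unique K) (#XK : #X K ≡ c) where

    open Cycle cycleK using (from; to; closing)

    Unique-K++ : ∀ {D} → Unique D → All (_∉ K) D → Unique (K ++ D)
    Unique-K++ uD out = Uniqueₚ.++⁺ uK uD λ { (v∈K , v∈D) → All.lookup out v∈D v∈K }

    fromSplit : ∀ {u xₖ k′ e x₁ xₚ yₖ y₀ y° y°° A B D} →
      Path (inj₁ u) (inj₁ xₖ) A → Path (inj₁ k′) (inj₁ e) B →
      xₖ ∈ₛ edge yₖ → k′ ∈ₛ edge yₖ → u ∈ₛ edge y₀ → e ∈ₛ edge y₀ →
      e ∈ₛ edge y° → x₁ ∈ₛ edge y° → xₖ ∈ₛ edge y°° → xₚ ∈ₛ edge y°° →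
      inj₂ yₖ ∷ inj₂ y₀ ∷ A ++ B ↭ K →
      Path (inj₁ x₁) (inj₁ xₚ) D → Unique D → All (_∉ K) D → inj₂ y° ∉ D → inj₂ y°° ∉ D →
      (y° ≡ y₀ ⊎ inj₂ y° ∉ K) → (y°° ≡ yₖ ⊎ inj₂ y°° ∉ K) → y° ≢ y°° → ⊥
    fromSplit {yₖ = yₖ} {y₀} {y°} {y°°} {A} {B} {D}
      pA pB xₖ∈yₖ k′∈yₖ u∈y₀ e∈y₀ e∈y° x₁∈y° xₖ∈y°° xₚ∈y°° σ pD uD out y°∉D y°°∉D o° o°° y°≢y°° = noEar (fromPath pA) (fromPath pB) xₖ∈yₖ k′∈yₖ u∈y₀ e∈y₀ e∈y° x₁∈y° xₖ∈y°°
            y°≢y°°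
            (differs (yₖ≢y₀ ∘ sym) (∈-resp-↭ σ (here refl)) o°)
            (differs yₖ≢y₀ (∈-resp-↭ σ (there (here refl))) o°°)
            (trans (count-↭ isX? σ) #XK) (length D) ≤-refl pD xₚ∈y°°
            (fits (Unique-resp-↭ (++⁺ (↭-sym σ) ↭-refl) (Unique-K++ uD out))
              (∉-AB y₀∉ o° y°∉D) (∉-AB yₖ∉ o°° y°°∉D))
      where
      uC : Unique (inj₂ yₖ ∷ inj₂ y₀ ∷ A ++ B)
      uC = Unique-resp-↭ (↭-sym σ) uK
      yₖ≢y₀ : yₖ ≢ y₀
      yₖ≢y₀ refl with uC
      ... | (≢ ∷ _) ∷ _ = ≢ refl
      y₀∉ : inj₂ y₀ ∉ A ++ B
      y₀∉ with uC
      ... | _ ∷ y₀≢ ∷ _ = All≢⇒∉ y₀≢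
      yₖ∉ : inj₂ yₖ ∉ A ++ B
      yₖ∉ with uC
      ... | (_ ∷ yₖ≢) ∷ _ = All≢⇒∉ yₖ≢
      ∉-AB : ∀ {y y′} → inj₂ y′ ∉ A ++ B → y ≡ y′ ⊎ inj₂ y ∉ K → inj₂ y ∉ D → inj₂ y ∉ (A ++ B) ++ D
      ∉-AB y′∉ o y∉D y∈ with ∈-++⁻ (A ++ B) y∈ | o
      ... | inj₂ y∈D  | _         = y∉D y∈D
      ... | inj₁ y∈AB | inj₁ refl = y′∉ y∈AB
      ... | inj₁ y∈AB | inj₂ y∉K  = y∉K (∈-resp-↭ σ (there (there y∈AB)))
      differs : ∀ {y y′ z} → y′ ≢ z → inj₂ z ∈ K → y ≡ y′ ⊎ inj₂ y ∉ K → y ≢ z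
      differs y′≢z z∈ (inj₁ refl) = y′≢z
      differs y′≢z z∈ (inj₂ y∉K) refl = y∉K z∈

    -- The start of the ear is normalised; what remains is its end `q′`. The two alternatives are an
    -- ear starting at `y₀`, which then serves as `y°`, and one starting at `e` with `y°` new. In
    -- both, the ear does not return to its start.
    fromHandle : ∀ {u e y₀ M y° x₁ h D q′} →
      Path (inj₁ u) (inj₁ e) M → u ∈ₛ edge y₀ → e ∈ₛ edge y₀ → inj₂ y₀ ∷ M ↭ K →
      e ∈ₛ edge y° → x₁ ∈ₛ edge y° → Path (inj₁ x₁) h D → h ~ q′ → q′ ∈ K →
      Unique D → All (_∉ K) D → inj₂ y° ∉ D →
      (y° ≡ y₀ × q′ ≢ inj₂ y₀) ⊎ (inj₂ y° ∉ K × q′ ≢ inj₁ e) → ⊥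
    fromHandle {u} {e} {y₀} {M} {y°} {x₁} {h} {D} {q′} p u∈y₀ e∈y₀ σ e∈y° x₁∈y° pD h~q′ q′∈ uD out y°∉D o =
        go q′ h pD h~q′ o (∈-resp-↭ (↭-sym σ) q′∈)
      where
      #XD : c < #X K + #X D
      #XD = subst (λ k → c < k + #X D) (sym #XK) (m<m+n c (#X-∈ (first∈ (fromPath pD))))
      uKD : Unique (inj₂ y₀ ∷ M ++ D)
      uKD = Unique-resp-↭ (++⁺ (↭-sym σ) ↭-refl) (Unique-K++ uD out)
      #XMD : c < #X (M ++ D)
      #XMD = subst (c <_) (sym (trans (count-++ isX? M D) (cong (_+ #X D) (count-↭ isX? σ)))) #XD
      weaken : ∀ {q′} → (y° ≡ y₀ × q′ ≢ inj₂ y₀) ⊎ (inj₂ y° ∉ K × q′ ≢ inj₁ e) → y° ≡ y₀ ⊎ inj₂ y° ∉ K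
      weaken (inj₁ (eq , _)) = inj₁ eq
      weaken (inj₂ (∉ , _)) = inj₂ ∉
      y°∉MD : ∀ {v} → inj₂ y° ∉ K → v ∈ inj₂ y₀ ∷ M ++ D → inj₂ y° ≢ v
      y°∉MD ∉K v∈ refl with ∈-++⁻ (inj₂ y₀ ∷ M) v∈
      ... | inj₁ v∈K = ∉K (∈-resp-↭ σ v∈K)
      ... | inj₂ v∈D = y°∉D v∈D

      atX : ∀ {xₖ y°°} → Path (inj₁ x₁) (inj₂ y°°) D → xₖ ∈ₛ edge y°° → xₖ ≢ e → y° ≡ y₀ ⊎ inj₂ y° ∉ K →
            inj₁ xₖ ∈ M → ⊥
      atX {xₖ} {y°°} pD xₖ∈ xₖ≢e o° xₖ∈M with mkUnsnoc (λ ()) (fromPath pD)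
      ... | unsnoc {inj₁ xₚ} {R} (pth {R′} pD′ τ) xₚ∈ ρ with splitAfter p xₖ∈M
      ...   | whole refl = xₖ≢e refl
      ...   | parts {inj₂ yₖ} {A} pA xₖ∈yₖ (_∷_ {b = inj₁ k′} {L = B} k′∈ pB) =
              fromSplit pA pB xₖ∈yₖ k′∈ u∈y₀ e∈y₀ e∈y° x₁∈y° xₖ∈ xₚ∈
                (↭-trans (solve 4 (λ k o a b → (k ⊕ o ⊕ a ⊕ b) ⊜ (o ⊕ a ⊕ k ⊕ b)) ↭-refl
                   (inj₂ yₖ ∷ []) (inj₂ y₀ ∷ []) A B) σ)
                pD′ (AllPairs.tail uR) (All.tail (All-resp-↭ (↭-sym ρ′) out))
                (λ y∈ → y°∉D (∈-resp-↭ ρ′ (there y∈))) (All≢⇒∉ (AllPairs.head uR)) o°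
                (inj₂ (All.lookup out (end∈ pD)))
                (λ { refl → y°∉D (end∈ pD) })
        where
        ρ′ : inj₂ y°° ∷ R′ ↭ D
        ρ′ = ↭-trans (↭-prep _ τ) ρ
        uR : Unique (inj₂ y°° ∷ R′)
        uR = Unique-resp-↭ (↭-sym ρ′) uD

      atAround : ∀ {yₖ xₚ M} → SplitAround (inj₁ u) (inj₁ e) (inj₂ yₖ) M → inj₂ y₀ ∷ M ↭ K →
                 Path (inj₁ x₁) (inj₁ xₚ) D → xₚ ∈ₛ edge yₖ → y° ≡ y₀ ⊎ inj₂ y° ∉ K → ⊥
      atAround {yₖ} (around {inj₁ xₖ} {inj₁ k′} {A} {B} pA xₖ∈ k′∈ pB) σ pD xₚ∈ o° =
        fromSplit pA pB xₖ∈ k′∈ u∈y₀ e∈y₀ e∈y° x₁∈y° xₖ∈ xₚ∈ σ′ pD uD out y°∉D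
          (λ y∈ → All.lookup out y∈ (∈-resp-↭ σ′ (here refl))) o° (inj₁ refl) (y°≢yₖ o°)
        where
        σ′ : inj₂ yₖ ∷ inj₂ y₀ ∷ A ++ B ↭ K
        σ′ = ↭-trans (solve 4 (λ k o a b → (k ⊕ o ⊕ a ⊕ b) ⊜ (o ⊕ a ⊕ k ⊕ b)) ↭-refl
               (inj₂ yₖ ∷ []) (inj₂ y₀ ∷ []) A B) σ
        y°≢yₖ : y° ≡ y₀ ⊎ inj₂ y° ∉ K → y° ≢ yₖ
        y°≢yₖ (inj₂ ∉K) refl = ∉K (∈-resp-↭ σ′ (here refl))
        y°≢yₖ (inj₁ refl) refl with Unique-resp-↭ (↭-sym σ′) uK
        ... | (≢ ∷ _) ∷ _ = ≢ refl

      atY : ∀ {yₖ xₚ M} → Path (inj₁ u) (inj₁ e) M → inj₂ y₀ ∷ M ↭ K → Path (inj₁ x₁) (inj₁ xₚ) D →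
            xₚ ∈ₛ edge yₖ → y° ≡ y₀ ⊎ inj₂ y° ∉ K → inj₂ yₖ ∈ M → ⊥
      atY [ _ ] _ _ _ _ (here ())
      atY (d ∷ p) σ pD xₚ∈ o° (there yₖ∈) = atAround (splitAround d p yₖ∈ (λ ())) σ pD xₚ∈ o°

      go : ∀ q′ h → Path (inj₁ x₁) h D → h ~ q′ →
           (y° ≡ y₀ × q′ ≢ inj₂ y₀) ⊎ (inj₂ y° ∉ K × q′ ≢ inj₁ e) → q′ ∈ inj₂ y₀ ∷ M → ⊥
      go _ h _ _ (inj₁ (_ , q′≢)) (here eq) = q′≢ eq
      -- The ear joins `e` and `y₀`, consecutive on the cycle, so inserting it between them makes
      -- the cycle too long.
      go (inj₂ _) (inj₁ xₚ) pD h~q′ (inj₂ (∉K , _)) (here refl) = tooLong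
        (All.tabulate (y°∉MD ∉K) ∷ uKD) #XMD
        (cyc (reorder (solve 4 (λ m y d o → (m ⊕ y ⊕ d ⊕ o) ⊜ (y ⊕ o ⊕ m ⊕ d)) ↭-refl
               M (inj₂ y° ∷ []) D (inj₂ y₀ ∷ []))
           (fromPath p ⟨ e∈y° ⟩ pt (inj₂ y°) ⟨ x₁∈y° ⟩ fromPath pD ⟨ h~q′ ⟩ pt (inj₂ y₀))) u∈y₀)
      go (inj₁ xₖ) (inj₂ y°°) pD h~q′ o (there xₖ∈) with xₖ Fin.≟ e | o
      ... | no xₖ≢e | _ = atX pD h~q′ xₖ≢e (weaken o) xₖ∈
      ... | yes refl | inj₂ (_ , ≢) = ≢ refl
      ... | yes refl | inj₁ (refl , _) = tooLong uKD #XMD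
        (cyc (reorder (solve 3 (λ m d o → (m ⊕ d ⊕ o) ⊜ (o ⊕ m ⊕ d)) ↭-refl M D (inj₂ y₀ ∷ []))
           (fromPath p ⟨ h~q′ ⟩ rev (fromPath pD) ⟨ x₁∈y° ⟩ pt (inj₂ y₀))) u∈y₀)
      go (inj₂ yₖ) (inj₁ xₚ) pD h~q′ o (there yₖ∈) = atY p σ pD h~q′ (weaken o) yₖ∈

    fromEar : ∀ {q q′ g h D} → q ∈ K → q′ ∈ K → q′ ≢ q → q ~ g → Path g h D → h ~ q′ →
              Unique D → All (_∉ K) D → 1 ≤ #X D → ⊥
    fromEar {inj₁ e} {q′} {inj₂ y°} q∈ q′∈ q′≢q e∈y° [ _ ] h~q′ uD out ()
    fromEar {inj₁ e} {q′} {inj₂ y°} q∈ q′∈ q′≢q e∈y° (_∷_ {b = inj₁ x₁} x₁∈ pD) h~q′ (y°≢ ∷ uD) (y°∉K ∷ out) _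
      with rotate cycleK q∈
    ... | inj₂ y₀ , pth (_∷_ {b = inj₁ u} u∈ p) σ , e∈y₀ =
          fromHandle p u∈ e∈y₀ σ e∈y° x₁∈ pD h~q′ q′∈ uD out (All≢⇒∉ y°≢) (inj₂ (y°∉K , q′≢q))
    fromEar {inj₂ y₀} {q′} {inj₁ x₁} q∈ q′∈ q′≢q x₁∈y₀ pD h~q′ uD out _ with rotate cycleK q∈
    ... | inj₁ u , P , u∈y₀ with mkUnsnoc (λ ()) P
    ...   | unsnoc {inj₁ e} (pth p τ) e∈y₀ ρ =
            fromHandle p u∈y₀ e∈y₀ (↭-trans (↭-prep _ τ) ρ) e∈y₀ x₁∈y₀ pD h~q′ q′∈ uD out
              (λ y∈ → All.lookup out y∈ q∈) (inj₁ (refl , q′≢q))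

    to∈ : to ∈ K
    to∈ = last∈ (Cycle.path cycleK)

    from∈ : from ∈ K
    from∈ = first∈ (Cycle.path cycleK)

    irrefl : ∀ {v} → ¬ v ~ v
    irrefl {inj₁ _} ()
    irrefl {inj₂ _} ()

    another : ∀ w → ∃[ t ] (t ∈ K × t ≢ w)
    another w with from ≟V w
    ... | no from≢w = from , from∈ , from≢w
    ... | yes refl = to , to∈ , λ { refl → irrefl closing }

    connect : ∀ {s w} → s ∉ K → s ≢ w → Hit K w s
    connect {s} {w} s∉ s≢w with another w
    ... | t , t∈ , t≢w = firstHit (noCut w s t s≢w t≢w) s∉ t∈

    spanning : ∀ {x₀} → inj₁ x₀ ∉ K → ⊥
    -- Which vertex is deleted is immaterial here, as long as it is not `x₀`; what counts is the
    -- last step onto `K`.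
    spanning {x₀} x₀∉ with connect {w = to} x₀∉ (λ { refl → x₀∉ to∈ })
    ... | hit {inj₁ x} {inj₂ y} p _ out _ x∈y y∈K _
        with connect {w = inj₂ y} (All.lookup out (end∈ p)) (λ ())
    ...   | hit p′ u′ out′ _ h~q′ q′∈ q′≢ =
            fromEar y∈K q′∈ q′≢ x∈y p′ h~q′ u′ out′ (#X-∈ (first∈ (fromPath p′)))
    -- The ear q y may lack an X-vertex, so `x` before `y` is led to `K` with `y` deleted. If it
    -- arrives at `q` again, `y` is led to `K` with `q` deleted; the new path either has an X-vertex
    -- itself or makes `y` adjacent to a second vertex of `K`.
    spanning {x₀} x₀∉ | hit {inj₂ y} {inj₁ q} p _ out _ q∈y q∈K _ with mkUnsnoc (λ ()) (fromPath p)
    ... | unsnoc {inj₁ x} r x∈y ρ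
        with connect {w = inj₂ y} (All.lookup (All-resp-↭ (↭-sym ρ) out) (there (last∈ r))) (λ ())
    ... | hit {hitPoint = q₁} {inner = D₁} p₁ u₁ out₁ y∉D₁ h₁~q₁ q₁∈ _ with q₁ ≟V inj₁ q
    ...   | no q₁≢q = fromEar q∈K q₁∈ q₁≢q q∈y (_∷_ {b = inj₁ x} x∈y p₁) h₁~q₁ (∉⇒All≢ y∉D₁ ∷ u₁)
              (All.lookup out (end∈ p) ∷ out₁) (#X-∈ {L = inj₂ y ∷ D₁} (there (first∈ (fromPath p₁))))
    ...   | yes refl with connect {w = inj₁ q} (All.lookup out (end∈ p)) (λ ())
    ...     | hit [ _ ] u₂ out₂ _ y~q₂ q₂∈ q₂≢q =
              fromEar q₂∈ q∈K (q₂≢q ∘ sym) (~-sym {inj₂ y} y~q₂) (_∷_ {b = inj₁ x} x∈y p₁) h₁~q₁ (∉⇒All≢ y∉D₁ ∷ u₁)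
              (All.lookup out (end∈ p) ∷ out₁) (#X-∈ {L = inj₂ y ∷ D₁} (there (first∈ (fromPath p₁))))
    ...     | hit p₂@(_∷_ {b = inj₁ x₂} {L = L₂} _ p₂′) u₂ out₂ _ h₂~q₂ q₂∈ q₂≢q =
              fromEar q∈K q₂∈ q₂≢q q∈y p₂ h₂~q₂ u₂ out₂
                (#X-∈ {L = inj₂ y ∷ L₂} (there (first∈ (fromPath p₂′))))

-- Berge cycles from cycles of the incidence graph.

anyVec? : ∀ {r} k {P : Vec (Fin r) k → Set} → Decidable P → Dec (∃[ v ] P v)
anyVec? zero P? = map′ ([] ,_) (λ { ([] , p) → p }) (P? [])
anyVec? (suc k) P? = map′ (λ (i , v , p) → i ∷ v , p) (λ { (i ∷ v , p) → i , v , p })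
  (Fin.any? λ i → anyVec? k (P? ∘ (i ∷_)))

next-inject₁ : ∀ {ℓ} (i : Fin ℓ) → next (inject₁ i) ≡ suc i
next-inject₁ {ℓ} i = Fin.toℕ-injective (trans (Fin.toℕ-fromℕ< _) (trans
  (m<n⇒m%n≡m {n = suc ℓ} (s≤s (subst (_< ℓ) (sym (Fin.toℕ-inject₁ i)) (Fin.toℕ<n i))))
  (cong suc (Fin.toℕ-inject₁ i))))

next-fromℕ : ∀ ℓ → next (fromℕ ℓ) ≡ zero
next-fromℕ ℓ = Fin.toℕ-injective (trans (Fin.toℕ-fromℕ< _)
  (trans (cong (λ k → suc k % suc ℓ) (Fin.toℕ-fromℕ ℓ)) (n%n≡0 (suc ℓ))))

module Hamilton {n m : ℕ} (H : Hypergraph n m) where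

  open Hypergraph H
  open Bipartite H

  -- Vectors in place of functions make existence decidable by exhaustive search, which turns the
  -- refutation of non-existence into a cycle.
  IsHamCycle : ∀ {k} → Vec (Fin n) k → Vec (Fin m) k → Set
  IsHamCycle bs ls =
    (∀ i j → lookup bs i ≡ lookup bs j → i ≡ j) ×
    (∀ i j → lookup ls i ≡ lookup ls j → i ≡ j) ×
    (∀ i → lookup bs i ∈ₛ edge (lookup ls i)) ×
    (∀ i → lookup bs (next i) ∈ₛ edge (lookup ls i)) ×
    (∀ v → ∃[ i ] lookup bs i ≡ v)

  HamCycle : ℕ → Set
  HamCycle k = ∃[ bs ] ∃[ ls ] IsHamCycle {k} bs ls

  hamCycle? : ∀ k → Dec (HamCycle k)
  hamCycle? k = anyVec? k λ bs → anyVec? k λ ls →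
    injective? bs ×-dec injective? ls ×-dec
    Fin.all? (λ i → lookup bs i ∈ₛ? edge (lookup ls i)) ×-dec
    Fin.all? (λ i → lookup bs (next i) ∈ₛ? edge (lookup ls i)) ×-dec
    Fin.all? (λ v → Fin.any? λ i → lookup bs i Fin.≟ v)
    where
    injective? : ∀ {r} (v : Vec (Fin r) k) → Dec (∀ i j → lookup v i ≡ lookup v j → i ≡ j)
    injective? v = Fin.all? λ i → Fin.all? λ j → (lookup v i Fin.≟ lookup v j) →-dec (i Fin.≟ j)

  toBerge : ∀ {k} → HamCycle k → HasHamiltonianBergeCycle H
  toBerge {k} (bs , ls , injb , injl , b∈ , n∈ , onto) = k , record
    { base = lookup bs ; base-injective = injb _ _
    ; label = lookup ls ; label-injective = injl _ _
    ; base∈ = b∈ ; next∈ = n∈ } , onto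

  record Chain (a : Fin n) (b : Fin m) (L : List V) : Set where
    constructor chain
    field
      {ℓ}   : ℕ
      bs    : Vec (Fin n) (suc ℓ)
      ls    : Vec (Fin m) (suc ℓ)
      size  : suc ℓ ≡ #X L
      first : lookup bs zero ≡ a
      last  : lookup ls (fromℕ ℓ) ≡ b
      here∈ : ∀ i → lookup bs i ∈ₛ edge (lookup ls i)
      step∈ : ∀ i → lookup bs (suc i) ∈ₛ edge (lookup ls (inject₁ i))
      bs∈   : ∀ i → inj₁ (lookup bs i) ∈ L
      ls∈   : ∀ i → inj₂ (lookup ls i) ∈ L
      bsInj : ∀ i j → lookup bs i ≡ lookup bs j → i ≡ j
      lsInj : ∀ i j → lookup ls i ≡ lookup ls j → i ≡ j
      onto  : ∀ {x} → inj₁ x ∈ L → ∃[ i ] lookup bs i ≡ x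

  ∷-injective : ∀ {A : Set} {k} {a : A} {v : Vec A k} → (∀ i → lookup v i ≢ a) →
    (∀ i j → lookup v i ≡ lookup v j → i ≡ j) →
    ∀ i j → lookup (a ∷ v) i ≡ lookup (a ∷ v) j → i ≡ j
  ∷-injective a∉ inj zero zero _ = refl
  ∷-injective a∉ inj zero (suc j) eq = ⊥-elim (a∉ j (sym eq))
  ∷-injective a∉ inj (suc i) zero eq = ⊥-elim (a∉ i eq)
  ∷-injective a∉ inj (suc i) (suc j) eq = cong suc (inj i j eq)

  toChain : ∀ {a b L} → Path (inj₁ a) (inj₂ b) L → Unique L → Chain a b L
  toChain {a} {b} (e ∷ [ _ ]) _ = chain (a ∷ []) (b ∷ []) refl refl refl
    (λ { zero → e }) (λ ()) (λ { zero → here refl }) (λ { zero → there (here refl) })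
    (λ { zero zero _ → refl }) (λ { zero zero _ → refl })
    (λ { (here refl) → zero , refl ; (there (here ())) })
  toChain {a} (_∷_ {b = inj₂ y} e (_∷_ {b = inj₁ a′} d p)) ((_ ∷ a≢) ∷ y≢ ∷ u) with toChain p u
  ... | chain bs ls size refl last h∈ s∈ bs∈ ls∈ bsi lsi on = chain (a ∷ bs) (y ∷ ls)
    (cong suc size) refl last
    (λ { zero → e ; (suc i) → h∈ i }) (λ { zero → d ; (suc i) → s∈ i })
    (λ { zero → here refl ; (suc i) → there (there (bs∈ i)) })
    (λ { zero → there (here refl) ; (suc i) → there (there (ls∈ i)) })
    (∷-injective (λ i eq → All≢⇒∉ a≢ (subst (λ x → inj₁ x ∈ _) eq (bs∈ i))) bsi)
    (∷-injective (λ i eq → All≢⇒∉ y≢ (subst (λ x → inj₂ x ∈ _) eq (ls∈ i))) lsi)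
    (λ { (here refl) → zero , refl ; (there (there x∈)) → let i , eq = on x∈ in suc i , eq })

  verticesX : List V
  verticesX = map inj₁ (allFin n)

  length-verticesX : length verticesX ≡ n
  length-verticesX = trans (length-map inj₁ (allFin n)) (length-tabulate {n = n} (λ i → i))

  #X≤n : ∀ {L} → Unique L → #X L ≤ n
  #X≤n {L} u = ≤-trans (Unique-⊆⇒length≤ (Uniqueₚ.filter⁺ isX? u) sub) (≤-reflexive length-verticesX)
    where
    sub : ∀ {v} → v ∈ filter isX? L → v ∈ verticesX
    sub v∈ with ∈-filter⁻ isX? {xs = L} v∈
    ... | _ , isX {x} = ∈-map⁺ inj₁ (∈-allFin x)

  missing : ∀ {L} → #X L < n → ∃[ x ] inj₁ x ∉ L
  missing {L} lt with Fin.any? (λ x → ¬? (inj₁ x ∈? L))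
  ... | yes found = found
  ... | no none = ⊥-elim (<⇒≱ lt (≤-trans (≤-reflexive (sym length-verticesX))
          (Unique-⊆⇒length≤ (Uniqueₚ.map⁺ Sum.inj₁-injective (allFin⁺ n)) sub)))
    where
    sub : ∀ {v} → v ∈ verticesX → v ∈ filter isX? L
    sub v∈ with ∈-map⁻ inj₁ v∈
    ... | x , _ , refl with inj₁ x ∈? L
    ...   | yes x∈ = ∈-filter⁺ isX? x∈ isX
    ...   | no x∉ = ⊥-elim (none (x , x∉))

  someY : ∀ {K} → Cycle K → ∃[ y ] inj₂ y ∈ K
  someY (cyc {inj₂ y} P _) = y , first∈ P
  someY (cyc {inj₁ _} {inj₂ y} P _) = y , last∈ P

  hamCycle : ∀ {K} → Cycle K → Unique K → #X K ≡ n → HamCycle n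
  hamCycle {K} C uK #X≡n = go (rotate C (proj₂ (someY C)))
    where
    all∈ : ∀ x → inj₁ x ∈ K
    all∈ x with inj₁ x ∈? K
    ... | yes x∈ = x∈
    ... | no x∉ = ⊥-elim (<⇒≱ (s≤s (≤-reflexive (sym #X≡n))) (#X≤n (∉⇒All≢ x∉ ∷ uK)))
    go : ∀ {y} → ∃[ r ] (Pth r (inj₂ y) K × inj₂ y ~ r) → HamCycle n
    go (inj₁ u , pth p σ , y~u) with toChain p (Unique-resp-↭ (↭-sym σ) uK)
    ... | chain {ℓ} bs ls size refl refl h∈ s∈ _ _ bsi lsi on =
          subst HamCycle (trans size (trans (count-↭ isX? σ) #X≡n))
            (bs , ls , bsi , lsi , h∈ , n∈ , λ v → on (∈-resp-↭ (↭-sym σ) (all∈ v)))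
      where
      n∈ : ∀ i → lookup bs (next i) ∈ₛ edge (lookup ls i)
      n∈ i with view i
      ... | ‵fromℕ = subst (λ j → lookup bs j ∈ₛ edge (lookup ls (fromℕ ℓ))) (sym (next-fromℕ ℓ)) y~u
      ... | ‵inject₁ j = subst (λ k → lookup bs k ∈ₛ edge (lookup ls (inject₁ j))) (sym (next-inject₁ j)) (s∈ j)

  -- Passage to a longest cycle.

  module _ {δ : ℕ} (n≤δ : n ≤ δ) (m+5≤3δ : m + 5 ≤ 3 * δ) (twoConnected : TwoConnected)
    (minDegree : MinDegree≥ δ) (¬ham : ¬ HamCycle n) where

    -- `k` bounds the number of X-vertices that the cycle misses. By induction no cycle has more
    -- X-vertices than `K`, so `K` is longest, and `spanning` refutes the vertex that it misses.
    noCycle : ∀ k {K} → Cycle K → Unique K → 1 ≤ #X K → n ≤ #X K + k → ⊥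
    noCycle zero C u _ n≤ =
      ¬ham (hamCycle C u (≤-antisym (#X≤n u) (≤-trans n≤ (≤-reflexive (+-identityʳ _)))))
    noCycle (suc k) {K} C u 1≤ n≤ with m≤n⇒m<n∨m≡n (#X≤n u)
    ... | inj₂ eq = ¬ham (hamCycle C u eq)
    ... | inj₁ lt = Ears.spanning H minDegree m+5≤3δ (<-≤-trans lt n≤δ) 1≤
            (Graph.TwoConnected.noCutVertex twoConnected) longest C u refl (proj₂ (missing lt))
      where
      longest : ∀ {L} → Cycle L → Unique L → #X L ≤ #X K
      longest {L} C′ u′ = ≮⇒≥ λ lt′ → noCycle k C′ u′ (≤-trans 1≤ (<⇒≤ lt′))
        (≤-trans n≤ (≤-trans (≤-reflexive (+-suc (#X K) k)) (+-monoˡ-≤ k lt′)))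

    someCycle : Fin n → ⊥
    someCycle x with Family.freshNeighbour minDegree [] x (≤-trans (≤-<-trans z≤n (Fin.toℕ<n x)) n≤δ)
    ... | y , _ , x∈y = noCycle n (cyc {from = inj₁ x} {to = inj₂ y} (fromPath (_∷_ {b = inj₂ y} x∈y [ inj₂ y ])) x∈y)
          (((λ ()) ∷ []) ∷ [] ∷ []) ≤-refl (m≤n+m n 1)

theorem4 : (n m δ : ℕ) → δ ≥ n → 3 * δ ≥ m + 5 →
    (H : Hypergraph n m) →
    Hypergraph.TwoConnected H →
    Hypergraph.MinDegree≥ H δ →
    HasHamiltonianBergeCycle H
-- Without vertices there is none to start from; the cycle of length zero is hamiltonian.
theorem4 zero m δ _ _ H _ _ = Hamilton.toBerge H {k = 0}
  ([] , [] , (λ ()) , (λ ()) , (λ ()) , (λ ()) , λ ())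
theorem4 n@(suc _) m δ n≤δ m+5≤3δ H twoConnected minDegree = toBerge (decidable-stable (hamCycle? n)
  λ ¬ham → someCycle n≤δ m+5≤3δ twoConnected minDegree ¬ham zero)
  where open Hamilton H
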